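{- Let $n\ge 2$ be an integer with $r$ distinct prime factors. Then for each $1\le j\le 2^r$, $$\lambda_j(-\tilde Q_n)+\varphi(n)\le \lambda_j(L_Q)\le \lambda_j(-\tilde Q_n)+n.$$
   Context: For a real symmetric $m\times m$ matrix $X$, $\lambda_1(X)\ge\dots\ge\lambda_m(X)$ denote its eigenvalues in decreasing order, with multiplicity. $\varphi$ is Euler's totient function. Let $p_1<\dots<p_r$ be the distinct primes dividing $n$ and $n_0=p_1\cdots p_r$. The divisors of $n_0$ are ordered as $(d_1,\dots,d_{2^r})$ recursively: for $r=1$ the order is $(1,p_1)$, and for $r$ primes the first $2^{r-1}$ entries are those for the primes $p_1,\dots,p_{r-1}$, the remaining $2^{r-1}$ entries being obtained by multiplying each of these, in order, by $p_r$. In particular $d_1=1$, $d_{2^r}=n_0$. For a divisor $d$ of $n_0$, $[d]=\{a\in\{0,1,\dots,n-1\}:\gcd(a,n_0)=d\}$ (with $\gcd(0,n_0)=n_0$), and $a_i=|[d_{i+1}]|$ for $1\le i\le 2^r-1$. The generating graph $\mathcal{E}_n$ of $\mathbb{Z}_n=\{0,\dots,n-1\}$ is the simple graph on $\mathbb{Z}_n$ in which distinct $a,b$ are adjacent iff $\langle a,b\rangle=\mathbb{Z}_n$ (iff $\gcd(a,b,n)=1$). All vertices in a class $[d_i]$ have the same degree in $\mathcal{E}_n$, denoted $\deg(d_i)$. For $i\ne j$ define $\rho_{1,j}=\rho_{j,1}=\sqrt{\varphi(n)a_{j-1}}$ for $j\ge2$, and for $i,j\ge 2$, $\rho_{i,j}=\sqrt{a_{i-1}a_{j-1}}$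 if $\gcd(d_i,d_j)=1$, $\rho_{i,j}=0$ otherwise. $\tilde Q_n$ is the symmetric $2^r\times2^r$ matrix with diagonal $(\varphi(n),0,\dots,0)$ and off-diagonal entries $\rho_{i,j}$. $L_Q$ is the symmetric $2^r\times 2^r$ matrix with diagonal $(n-\varphi(n),\deg(d_2),\dots,\deg(d_{2^r-1}),\varphi(n))$ and off-diagonal entries $-\rho_{i,j}$; it is the symmetric matrix associated with the Laplacian of $\mathcal{E}_n$. -}

module Defs where

open import Level using (Level; _⊔_) renaming (suc to lsuc)
open import Data.Bool using (if_then_else_)
open import Data.Fin as Fin using (Fin; toℕ; punchIn)
import Data.Fin.Properties as Finₚ
open import Data.List using (List; upTo; allFin; filter; length)
open import Data.Nat as ℕ using (ℕ; zero; suc; NonZero)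
open import Data.Nat.Coprimality using (coprime?)
open import Data.Nat.Divisibility using (_∣_; _∣?_)
open import Data.Nat.DivMod using (_%_; _mod_)
open import Data.Nat.GCD using (gcd)
open import Data.Nat.ListAction using (product)
open import Data.Nat.Primality using (Prime; prime?)
open import Data.Product using (∃; ∃-syntax; _×_)
open import Data.Sum using (_⊎_)
open import Data.Vec as Vec using (Vec; []; _∷_; _++_)
open import Relation.Binary using (Rel; IsStrictPartialOrder)
open import Relation.Binary.PropositionalEquality using (_≡_; _≢_)
open import Relation.Nullary using (¬_; Dec; does; ¬?; _×-dec_)
open import Relation.Unary using (Pred; Decidable)
open import Algebra.Apartness using (HeytingCommutativeRing; HeytingField)
open import Algebra.Bundles using (CommutativeRing; RawSemiring; Semiring)
import Algebra.Definitions.RawSemiring as RawSemiringDefs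

-- The real numbers, given by their axioms: an Archimedean ordered field in
-- which every Cauchy sequence converges.  The axioms are chosen so that both
-- the classical reals and the setoid of constructive Cauchy reals satisfy
-- them; in particular the order is not assumed to be decidable.

record RealNumbers (c ℓ₁ ℓ₂ : Level) : Set (lsuc (c ⊔ ℓ₁ ⊔ ℓ₂)) where
  infix 4 _<_ _≤_
  field
    heytingField : HeytingField c ℓ₁ ℓ₂

  open HeytingField heytingField public

  private
    rawSemiring : RawSemiring c ℓ₁
    rawSemiring = Semiring.rawSemiring (CommutativeRing.semiring
      (HeytingCommutativeRing.commutativeRing heytingCommutativeRing))

  open RawSemiringDefs rawSemiring public
    using (sum; _^_)
    renaming (_×_ to _·_; product to ∏)

  fromℕ : ℕ → Carrier
  fromℕ k = k · 1#

  field
    _<_                    : Rel Carrier ℓ₂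
    <-isStrictPartialOrder : IsStrictPartialOrder _≈_ _<_
    #⇒<⊎>                  : ∀ {x y} → x # y → x < y ⊎ y < x
    <⇒#                    : ∀ {x y} → x < y → x # y
    0<1                    : 0# < 1#
    +-monoˡ-<              : ∀ z {x y} → x < y → x + z < y + z
    *-pos                  : ∀ {x y} → 0# < x → 0# < y → 0# < x * y
    archimedean            : ∀ x → ∃[ k ] x < fromℕ k

  _≤_ : Rel Carrier ℓ₂
  x ≤ y = ¬ (y < x)

  IsCauchy : (ℕ → Carrier) → Set (c ⊔ ℓ₂)
  IsCauchy s = ∀ ε → 0# < ε →
    ∃[ N ] (∀ i j → N ℕ.≤ i → N ℕ.≤ j → s i < s j + ε)

  ConvergesTo : (ℕ → Carrier) → Carrier → Set (c ⊔ ℓ₂)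
  ConvergesTo s l = ∀ ε → 0# < ε →
    ∃[ N ] (∀ i → N ℕ.≤ i → s i < l + ε × l < s i + ε)

  field
    complete : ∀ s → IsCauchy s → ∃[ l ] ConvergesTo s l

    -- Square roots exist by completeness and are unique; they are included
    -- as an operation, unconstrained on negative numbers.
    √        : Carrier → Carrier
    √-nonneg : ∀ {x} → 0# ≤ x → 0# ≤ √ x
    √-square : ∀ {x} → 0# ≤ x → √ x * √ x ≈ x

module LinearAlgebra {c ℓ₁ ℓ₂} (ℝ : RealNumbers c ℓ₁ ℓ₂) where
  open RealNumbers ℝ

  Matrix : ℕ → Set c
  Matrix m = Fin m → Fin m → Carrier

  neg : ∀ {m} → Matrix m → Matrix m
  neg X i j = - X i j

  -- Laplace expansion along the first row.
  det : ∀ {m} → Matrix m → Carrier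
  det {zero}  X = 1#
  det {suc m} X = sum λ j →
    (- 1#) ^ toℕ j * X Fin.zero j * det (λ k l → X (Fin.suc k) (punchIn j l))

  scalar : ∀ {m} → Carrier → Matrix m
  scalar x i j = if does (i Fin.≟ j) then x else 0#

  charPoly : ∀ {m} → Matrix m → Carrier → Carrier
  charPoly X x = det (λ i j → scalar x i j - X i j)

  -- λs lists the eigenvalues λ₁(X) ≥ … ≥ λₘ(X) of X, with multiplicity as
  -- roots of the characteristic polynomial.  The field is infinite, so the
  -- pointwise identity is an identity of polynomials.
  record IsSpectrum {m} (X : Matrix m) (λs : Fin m → Carrier) : Set (c ⊔ ℓ₁ ⊔ ℓ₂) where
    field
      decreasing : ∀ {i j} → i Fin.≤ j → λs j ≤ λs i
      splits     : ∀ x → charPoly X x ≈ ∏ (λ i → x - λs i)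

count : ∀ {n p} {P : Pred (Fin n) p} → Decidable P → ℕ
count P? = length (filter P? (allFin _))

-- Euler's totient; counting over 0 , … , n - 1 instead of 1 , … , n is
-- harmless since gcd 0 n ≡ gcd n n.
φ : ℕ → ℕ
φ n = count {n} (λ k → coprime? (toℕ k) n)

primeDivisors : ℕ → List ℕ
primeDivisors n = filter (λ p → prime? p ×-dec p ∣? n) (upTo (suc n))

ω : ℕ → ℕ
ω n = length (primeDivisors n)

-- The products of subsets of p₁ , … , pᵣ : each new prime appends its
-- multiples of the products obtained so far.
subsetProducts : ∀ {r} → Vec ℕ r → Vec ℕ (2 ℕ.^ r)
subsetProducts = Vec.foldl (λ r → Vec ℕ (2 ℕ.^ r))
  (λ ds p → ds ++ (Vec.map (ℕ._* p) ds ++ [])) (1 ∷ [])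

-- The vertex set of the generating graph, ℤₙ = {0 , … , n - 1}, is Fin n, and
-- an index i of the 2ʳ × 2ʳ matrices stands for i + 1 in 1-based notation.
module GeneratingGraph (n : ℕ) .{{_ : NonZero n}} where

  r : ℕ
  r = ω n

  n₀ : ℕ
  n₀ = product (primeDivisors n)

  d : Fin (2 ℕ.^ r) → ℕ
  d = Vec.lookup (subsetProducts (Vec.fromList (primeDivisors n)))

  class? : (e : ℕ) → Decidable {A = Fin n} (λ a → gcd (toℕ a) n₀ ≡ e)
  class? e a = gcd (toℕ a) n₀ ℕ.≟ e

  -- The size of [dᵢ]: the number aᵢ₋₁ in 1-based notation, and φ(n) for i = 1.
  a : Fin (2 ℕ.^ r) → ℕ
  a i = count (class? (d i))

  -- ⟨ a , b ⟩ = ℤₙ: every residue is of the form xa + yb.  The coefficients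
  -- only matter modulo n.
  Generates : Fin n → Fin n → Set
  Generates a b = (c : Fin n) → ∃[ x ] ∃[ y ]
    (toℕ {n} x ℕ.* toℕ a ℕ.+ toℕ {n} y ℕ.* toℕ b) % n ≡ toℕ c

  generates? : ∀ a b → Dec (Generates a b)
  generates? a b = Finₚ.all? λ c → Finₚ.any? λ x → Finₚ.any? λ y →
    (toℕ x ℕ.* toℕ a ℕ.+ toℕ y ℕ.* toℕ b) % n ℕ.≟ toℕ c

  Adjacent : Fin n → Fin n → Set
  Adjacent a b = a ≢ b × Generates a b

  adjacent? : ∀ a b → Dec (Adjacent a b)
  adjacent? a b = ¬? (a Fin.≟ b) ×-dec generates? a b

  degree : Fin n → ℕ
  degree a = count (adjacent? a)

  -- The common degree of the vertices in [dᵢ], computed at the residue of dᵢ,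
  -- which lies in that class because n₀ divides n.
  deg : Fin (2 ℕ.^ r) → ℕ
  deg i = degree (d i mod n)

  module Matrices {c ℓ₁ ℓ₂} (ℝ : RealNumbers c ℓ₁ ℓ₂) where
    open RealNumbers ℝ
    open LinearAlgebra ℝ

    ρ : Fin (2 ℕ.^ r) → Fin (2 ℕ.^ r) → Carrier
    ρ i j with toℕ i | toℕ j
    ... | zero  | _     = √ (fromℕ (φ n ℕ.* a j))
    ... | suc _ | zero  = √ (fromℕ (φ n ℕ.* a i))
    ... | suc _ | suc _ =
      if does (gcd (d i) (d j) ℕ.≟ 1) then √ (fromℕ (a i ℕ.* a j)) else 0#

    Q̃-diagonal : Fin (2 ℕ.^ r) → Carrier
    Q̃-diagonal i = if does (toℕ i ℕ.≟ 0) then fromℕ (φ n) else 0#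

    Q̃ : Matrix (2 ℕ.^ r)
    Q̃ i j = if does (i Fin.≟ j) then Q̃-diagonal i else ρ i j

    L-diagonal : Fin (2 ℕ.^ r) → Carrier
    L-diagonal i =
      if does (toℕ i ℕ.≟ 0) then fromℕ n - fromℕ (φ n)
      else if does (suc (toℕ i) ℕ.≟ 2 ℕ.^ r) then fromℕ (φ n)
      else fromℕ (deg i)

    L : Matrix (2 ℕ.^ r)
    L i j = if does (i Fin.≟ j) then L-diagonal i else - ρ i j

{-# OPTIONS --safe #-}
-- L + Q̃ is a diagonal matrix, with entries n at d₁, φ(n) at n₀ and deg(dᵢ)
-- otherwise.  A unit of ℤₙ generates together with every element, and dᵢ is no
-- unit for i > 1, so φ(n) ≤ deg(dᵢ) ≤ n.  Hence, as quadratic forms,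
-- -Q̃ + φ(n) I ≤ L ≤ -Q̃ + n I, and Weyl's monotonicity principle applies.
--
-- An inequality x ≤ y is a negation, so the argument may be carried out under
-- double negation: eigenvectors, pivots and intersections of eigenspaces are
-- only shown to exist in this weak sense.
module Submission where

open import Defs
open import Algebra.Apartness using (HeytingCommutativeRing)
import Algebra.Apartness.Properties.HeytingCommutativeRing as HeytingProperties
open import Algebra.Bundles using (CommutativeRing; RawRing)
import Algebra.Properties.CommutativeSemigroup as CommutativeSemigroupProperties
import Algebra.Properties.Ring as RingProperties
import Algebra.Properties.Semiring.Mult as Multiples
import Algebra.Properties.Semiring.Sum as Sums
import Algebra.Solver.Ring as RingSolver
open import Algebra.Solver.Ring.AlmostCommutativeRing
  using (fromCommutativeRing; _-Raw-AlmostCommutative⟶_; Induced-equivalence)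
open import Data.Bool using (if_then_else_)
open import Data.Empty using (⊥; ⊥-elim)
open import Data.Fin as Fin using (Fin; toℕ; punchIn; inject₁)
open import Data.Fin.Induction using (<-weakInduction)
import Data.Fin.Properties as Finₚ
open import Data.List as List using (allFin)
import Data.List.Properties as Listₚ
import Data.List.Relation.Binary.Sublist.Propositional as Sublist
import Data.List.Relation.Binary.Sublist.Propositional.Properties as Sublistₚ
import Data.List.Relation.Unary.All.Properties as ListAllₚ
open import Data.Maybe using (just; nothing)
open import Data.Nat as ℕ using (ℕ; zero; suc; NonZero)
open import Data.Nat.Coprimality using (Coprime; coprime?; coprime-Bézout)
open import Data.Nat.Divisibility using (_∣_; _∣?_; n∣m*n; %-presˡ-∣)
open import Data.Nat.DivMod
  using (_%_; _mod_; %-distribˡ-*; m%n%n≡m%n; m%n<n; m<n⇒m%n≡m; m*n%n≡0;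
         [m+n]%n≡m%n; [m+kn]%n≡m%n)
open import Data.Nat.GCD using (gcd-comm; module Bézout)
open import Data.Nat.Primality using (Prime; prime?; ¬prime[1])
import Data.Nat.Properties as ℕₚ
open import Data.Nat.Tactic.RingSolver using (solve-∀)
open import Data.Product using (∃-syntax; _×_; _,_; proj₁; proj₂)
open import Data.Sum using (_⊎_; inj₁; inj₂; [_,_])
open import Data.Vec as Vec using (Vec)
open import Data.Vec.Functional using (_∷_; insertAt; updateAt; tail)
import Data.Vec.Functional.Properties as Vectorₚ
import Data.Vec.Properties as Vecₚ
import Data.Vec.Relation.Unary.All as VecAll
import Data.Vec.Relation.Unary.All.Properties as VecAllₚ
open import Function using (_∘_; _$_; const; id)
open import Level using (Level; _⊔_; Lift; lift)
open import Relation.Binary using (IsStrictPartialOrder)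
open import Relation.Binary.Definitions using (WeaklyDecidable)
open import Relation.Binary.PropositionalEquality as ≡ using (_≡_; _≢_)
import Relation.Binary.Reasoning.Setoid as SetoidReasoning
open import Relation.Nullary using (¬_; Dec; yes; no; does; _×-dec_)
open import Relation.Nullary.Decidable using (dec-true; dec-false; ¬¬-excluded-middle)
open import Relation.Unary using (Decidable; _⊆_)

-- The spectra are given only through the pointwise splitting of characteristic polynomials, so the
-- spectral theorem has to start from determinants: a root makes `det` vanish, and this must yield
-- an eigenvector. Multiplicativity of `det`, obtained from the uniqueness of alternating forms,
-- serves twice: it carries a vanishing determinant through Gaussian elimination, and it makes
-- `charPoly` invariant under conjugation. The orthogonal changes of basis are built from
-- reflections, which are symmetric and their own inverses, so that one unit eigenvector is enough
-- to write such a change down. Splitting off an eigenvalue α leaves the wanted identity of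
-- characteristic polynomials multiplied by x - α. This factor cannot be cancelled at x = α, and the
-- gap is closed by the fact that a polynomial function vanishing on a half-line vanishes
-- everywhere.

-- Ordered field arithmetic with an undecidable order, and a ring solver.

module OrderedField {c ℓ₁ ℓ₂ : Level} (ℝ : RealNumbers c ℓ₁ ℓ₂) where
  open RealNumbers ℝ hiding (zero)

  commutativeRing : CommutativeRing c ℓ₁
  commutativeRing = HeytingCommutativeRing.commutativeRing heytingCommutativeRing

  open CommutativeRing commutativeRing using (semiring; ring)
  open Multiples semiring using (×-homo-+; ×1-homo-*)
  open HeytingProperties heytingCommutativeRing using (x-0≈x)

  open SetoidReasoning setoid

  -- The pair (a , b) stands for the integer a - b.  The two special cases make
  -- the constants 0 and 1 of the solver denote 0# and 1# definitionally.
  private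
    Difference : RawRing _ _
    Difference = record
      { Carrier = ℕ × ℕ
      ; _≈_ = _≡_
      ; _+_ = λ { (a , b) (c , d) → a ℕ.+ c , b ℕ.+ d }
      ; _*_ = λ { (a , b) (c , d) → a ℕ.* c ℕ.+ b ℕ.* d , a ℕ.* d ℕ.+ b ℕ.* c }
      ; -_  = λ { (a , b) → b , a }
      ; 0#  = 0 , 0
      ; 1#  = 1 , 0
      }

    value : ℕ × ℕ → Carrier
    value (0 , 0) = 0#
    value (1 , 0) = 1#
    value (a , b) = fromℕ a - fromℕ b

    open RingProperties ring
      using (-‿distribˡ-*; -‿distribʳ-*; -‿involutive; -‿+-comm)
    open CommutativeSemigroupProperties (CommutativeRing.+-commutativeSemigroup commutativeRing)
      using () renaming (interchange to +-interchange)

    value-≈ : ∀ a b → value (a , b) ≈ fromℕ a - fromℕ b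
    value-≈ 0 0 = sym (-‿inverseʳ 0#)
    value-≈ 1 0 = sym (trans (x-0≈x _) (+-identityʳ 1#))
    value-≈ 0 (suc b) = refl
    value-≈ 1 (suc b) = refl
    value-≈ (suc (suc a)) b = refl

    difference-+ : ∀ a b c d → (a + c) - (b + d) ≈ (a - b) + (c - d)
    difference-+ a b c d = begin
      (a + c) - (b + d)        ≈⟨ +-congˡ (-‿+-comm b d) ⟨
      (a + c) + (- b + - d)    ≈⟨ +-interchange a c (- b) (- d) ⟩
      (a - b) + (c - d)        ∎

    difference-neg : ∀ a b → b - a ≈ - (a - b)
    difference-neg a b = begin
      b - a          ≈⟨ +-comm b (- a) ⟩
      - a + b        ≈⟨ +-congˡ (-‿involutive b) ⟨
      - a + - - b    ≈⟨ -‿+-comm a (- b) ⟩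
      - (a - b)      ∎

    difference-* : ∀ a b c d →
      (a * c + b * d) - (a * d + b * c) ≈ (a - b) * (c - d)
    difference-* a b c d = begin
      (a * c + b * d) - (a * d + b * c)
        ≈⟨ difference-+ (a * c) (a * d) (b * d) (b * c) ⟩
      (a * c - a * d) + (b * d - b * c)
        ≈⟨ +-cong (distrib-- a c d) (trans (distrib-- b d c) (trans
             (*-congˡ (difference-neg c d)) (trans (sym (-‿distribʳ-* b _)) (-‿distribˡ-* b _)))) ⟩
      a * (c - d) + - b * (c - d)
        ≈⟨ distribʳ (c - d) a (- b) ⟨
      (a - b) * (c - d) ∎
      where
      distrib-- : ∀ x y z → x * y - x * z ≈ x * (y - z)
      distrib-- x y z = trans (+-congˡ (-‿distribʳ-* x z)) (sym (distribˡ x y (- z)))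

    value-homomorphism : Difference -Raw-AlmostCommutative⟶ fromCommutativeRing commutativeRing
    value-homomorphism = record
      { ⟦_⟧ = value
      ; +-homo = λ { (a , b) (c , d) → begin
          value (a ℕ.+ c , b ℕ.+ d)                    ≈⟨ value-≈ (a ℕ.+ c) (b ℕ.+ d) ⟩
          fromℕ (a ℕ.+ c) - fromℕ (b ℕ.+ d)
            ≈⟨ +-cong (×-homo-+ 1# a c) (-‿cong (×-homo-+ 1# b d)) ⟩
          (fromℕ a + fromℕ c) - (fromℕ b + fromℕ d)    ≈⟨ difference-+ _ _ _ _ ⟩
          (fromℕ a - fromℕ b) + (fromℕ c - fromℕ d)    ≈⟨ +-cong (value-≈ a b) (value-≈ c d) ⟨
          value (a , b) + value (c , d) ∎ }
      ; *-homo = λ { (a , b) (c , d) → begin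
          value (a ℕ.* c ℕ.+ b ℕ.* d , a ℕ.* d ℕ.+ b ℕ.* c)
            ≈⟨ value-≈ (a ℕ.* c ℕ.+ b ℕ.* d) (a ℕ.* d ℕ.+ b ℕ.* c) ⟩
          fromℕ (a ℕ.* c ℕ.+ b ℕ.* d) - fromℕ (a ℕ.* d ℕ.+ b ℕ.* c)
            ≈⟨ +-cong (fromℕ-+* a c b d) (-‿cong (fromℕ-+* a d b c)) ⟩
          (fromℕ a * fromℕ c + fromℕ b * fromℕ d) - (fromℕ a * fromℕ d + fromℕ b * fromℕ c)
            ≈⟨ difference-* _ _ _ _ ⟩
          (fromℕ a - fromℕ b) * (fromℕ c - fromℕ d)    ≈⟨ *-cong (value-≈ a b) (value-≈ c d) ⟨
          value (a , b) * value (c , d) ∎ }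
      ; -‿homo = λ { (a , b) → trans (value-≈ b a)
          (trans (difference-neg _ _) (-‿cong (sym (value-≈ a b)))) }
      ; 0-homo = refl
      ; 1-homo = refl
      }
      where
      fromℕ-+* : ∀ a c b d →
        fromℕ (a ℕ.* c ℕ.+ b ℕ.* d) ≈ fromℕ a * fromℕ c + fromℕ b * fromℕ d
      fromℕ-+* a c b d = trans (×-homo-+ 1# (a ℕ.* c) (b ℕ.* d))
        (+-cong (×1-homo-* a c) (×1-homo-* b d))

    -- An integer has many representations `(a , b)`, so the coefficients of normal forms are
    -- compared by cross sums, `a + d` against `c + b`.
    _value≟_ : WeaklyDecidable (Induced-equivalence value-homomorphism)
    (a , b) value≟ (c , d) with a ℕ.≟ c | b ℕ.≟ d
    ... | yes ≡.refl | yes ≡.refl = just refl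
    ... | _ | _ with a ℕ.+ d ℕ.≟ c ℕ.+ b
    ...   | no _ = nothing
    ...   | yes e = just (begin
      value (a , b)                                ≈⟨ value-≈ a b ⟩
      fromℕ a - fromℕ b                            ≈⟨ +-identityʳ _ ⟨
      (fromℕ a - fromℕ b) + 0#                     ≈⟨ +-congˡ (-‿inverseʳ (fromℕ d)) ⟨
      (fromℕ a - fromℕ b) + (fromℕ d - fromℕ d)    ≈⟨ difference-+ _ _ _ _ ⟨
      (fromℕ a + fromℕ d) - (fromℕ b + fromℕ d)    ≈⟨ +-cong (sym (×-homo-+ 1# a d)) (-‿cong (+-comm _ _)) ⟩
      fromℕ (a ℕ.+ d) - (fromℕ d + fromℕ b)        ≡⟨ ≡.cong (λ k → fromℕ k - (fromℕ d + fromℕ b)) e ⟩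
      fromℕ (c ℕ.+ b) - (fromℕ d + fromℕ b)        ≈⟨ +-congʳ (×-homo-+ 1# c b) ⟩
      (fromℕ c + fromℕ b) - (fromℕ d + fromℕ b)    ≈⟨ difference-+ _ _ _ _ ⟩
      (fromℕ c - fromℕ d) + (fromℕ b - fromℕ b)    ≈⟨ +-congˡ (-‿inverseʳ (fromℕ b)) ⟩
      (fromℕ c - fromℕ d) + 0#                     ≈⟨ +-identityʳ _ ⟩
      fromℕ c - fromℕ d                            ≈⟨ value-≈ c d ⟨
      value (c , d) ∎)

  open RingSolver Difference (fromCommutativeRing commutativeRing) value-homomorphism _value≟_ public
    using (Polynomial; solve; _:=_; _:+_; _:*_; _:-_; :-_; con)

  :0 :1 : ∀ {k} → Polynomial k
  :0 = con (0 , 0)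
  :1 = con (1 , 0)

  open IsStrictPartialOrder <-isStrictPartialOrder public using (<-resp-≈)
    renaming (irrefl to <-irrefl; trans to <-trans)

  private variable
    w x y z : Carrier

  inverse : x # 0# → ∃[ x⁻¹ ] x * x⁻¹ ≈ 1#
  inverse {x} x#0 with #⇒invertible x#0
  ... | x⁻¹ , _ , right = x⁻¹ , trans (*-congʳ (sym (x-0≈x x))) right

  cancel-*ˡ : x # 0# → x * y ≈ x * z → y ≈ z
  cancel-*ˡ {x} {y} {z} x#0 xy≈xz = let x⁻¹ , xx⁻¹ = inverse x#0 in begin
    y                ≈⟨ *-identityˡ y ⟨
    1# * y           ≈⟨ *-congʳ xx⁻¹ ⟨
    (x * x⁻¹) * y    ≈⟨ solve 3 (λ a b c → a :* b :* c := b :* (a :* c)) refl x x⁻¹ y ⟩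
    x⁻¹ * (x * y)    ≈⟨ *-congˡ xy≈xz ⟩
    x⁻¹ * (x * z)    ≈⟨ solve 3 (λ a b c → b :* (a :* c) := a :* b :* c) refl x x⁻¹ z ⟩
    (x * x⁻¹) * z    ≈⟨ *-congʳ xx⁻¹ ⟩
    1# * z           ≈⟨ *-identityˡ z ⟩
    z                ∎

  ¬#⇒≈ : ¬ x # y → x ≈ y
  ¬#⇒≈ = proj₁ (tight _ _)

  -- Tightness turns the failure of apartness into equality. Hence the case distinctions that are
  -- missing constructively are available whenever the goal is a negation, as every `≤` is.
  ¬¬#⊎≈ : ∀ x y → ¬ ¬ (x # y ⊎ x ≈ y)
  ¬¬#⊎≈ x y k = k (inj₂ (¬#⇒≈ λ x#y → k (inj₁ x#y)))

  ≤⇒¬¬<⊎≈ : x ≤ y → ¬ ¬ (x < y ⊎ x ≈ y)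
  ≤⇒¬¬<⊎≈ x≤y k = k (inj₂ (¬#⇒≈ λ x#y → [ (λ x<y → k (inj₁ x<y)) , x≤y ] (#⇒<⊎> x#y)))

  ≈-<-trans : x ≈ y → y < z → x < z
  ≈-<-trans x≈y = proj₂ <-resp-≈ (sym x≈y)

  <-≈-trans : x < y → y ≈ z → x < z
  <-≈-trans x<y y≈z = proj₁ <-resp-≈ y≈z x<y

  <⇒≤ : x < y → x ≤ y
  <⇒≤ x<y y<x = <-irrefl refl (<-trans x<y y<x)

  ≈⇒≤ : x ≈ y → x ≤ y
  ≈⇒≤ x≈y y<x = <-irrefl (sym x≈y) y<x

  ≤-trans : x ≤ y → y ≤ z → x ≤ z
  ≤-trans x≤y y≤z z<x = ≤⇒¬¬<⊎≈ x≤y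
    [ (λ x<y → y≤z (<-trans z<x x<y)) , (λ x≈y → y≤z (<-≈-trans z<x x≈y)) ]

  ≤-respˡ : x ≈ y → x ≤ z → y ≤ z
  ≤-respˡ x≈y = ≤-trans (≈⇒≤ (sym x≈y))

  ≤-respʳ : y ≈ z → x ≤ y → x ≤ z
  ≤-respʳ y≈z x≤y = ≤-trans x≤y (≈⇒≤ y≈z)

  x<y⇒0<y-x : x < y → 0# < y - x
  x<y⇒0<y-x {x} x<y = ≈-<-trans (sym (-‿inverseʳ x)) (+-monoˡ-< (- x) x<y)

  0<y-x⇒x<y : 0# < y - x → x < y
  0<y-x⇒x<y {y} {x} 0<y-x = ≈-<-trans (sym (+-identityˡ x)) (<-≈-trans (+-monoˡ-< x 0<y-x)
    (solve 2 (λ x y → y :- x :+ x := y) refl x y))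

  x≤y⇒0≤y-x : x ≤ y → 0# ≤ y - x
  x≤y⇒0≤y-x {x} {y} x≤y y-x<0 = x≤y (0<y-x⇒x<y (<-≈-trans (x<y⇒0<y-x y-x<0)
    (solve 2 (λ x y → :0 :- (y :- x) := x :- y) refl x y)))

  0≤y-x⇒x≤y : 0# ≤ y - x → x ≤ y
  0≤y-x⇒x≤y {y} {x} 0≤y-x y<x = 0≤y-x (0<y-x⇒x<y (<-≈-trans (x<y⇒0<y-x y<x)
    (solve 2 (λ x y → x :- y := :0 :- (y :- x)) refl x y)))

  -- The proof splits on `0# < y` or `0# ≈ y`, which is available only weakly; hence the double
  -- negation in the conclusion.
  +-pos-nonneg : 0# < x → 0# ≤ y → ¬ ¬ (0# < x + y)
  +-pos-nonneg {x} {y} 0<x 0≤y k = ≤⇒¬¬<⊎≈ 0≤y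
    [ (λ 0<y → k (<-trans (<-≈-trans 0<y (sym (+-identityˡ y))) (+-monoˡ-< y 0<x)))
    , (λ 0≈y → k (<-≈-trans 0<x (trans (sym (+-identityʳ x)) (+-congˡ 0≈y)))) ]

  +-nonneg : 0# ≤ x → 0# ≤ y → 0# ≤ x + y
  +-nonneg 0≤x 0≤y x+y<0 = ≤⇒¬¬<⊎≈ 0≤x
    [ (λ 0<x → +-pos-nonneg 0<x 0≤y λ 0<x+y → <⇒≤ 0<x+y x+y<0)
    , (λ 0≈x → 0≤y (≈-<-trans (trans (sym (+-identityˡ _)) (+-congʳ 0≈x)) x+y<0)) ]

  *-nonneg : 0# ≤ x → 0# ≤ y → 0# ≤ x * y
  *-nonneg {x} {y} 0≤x 0≤y xy<0 = ≤⇒¬¬<⊎≈ 0≤x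
    [ (λ 0<x → ≤⇒¬¬<⊎≈ 0≤y
      [ (λ 0<y → <⇒≤ (*-pos 0<x 0<y) xy<0)
      , (λ 0≈y → <-irrefl (trans (*-congˡ (sym 0≈y)) (zeroʳ x)) xy<0) ])
    , (λ 0≈x → <-irrefl (trans (*-congʳ (sym 0≈x)) (zeroˡ y)) xy<0) ]

  +-mono-≤ : w ≤ x → y ≤ z → w + y ≤ x + z
  +-mono-≤ {w} {x} {y} {z} w≤x y≤z = 0≤y-x⇒x≤y (≤-respʳ
    (solve 4 (λ w x y z → (x :- w) :+ (z :- y) := (x :+ z) :- (w :+ y)) refl w x y z)
    (+-nonneg (x≤y⇒0≤y-x w≤x) (x≤y⇒0≤y-x y≤z)))

  *-monoʳ-≤ : 0# ≤ z → x ≤ y → x * z ≤ y * z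
  *-monoʳ-≤ {z} {x} {y} 0≤z x≤y = 0≤y-x⇒x≤y (≤-respʳ
    (solve 3 (λ x y z → (y :- x) :* z := y :* z :- x :* z) refl x y z)
    (*-nonneg (x≤y⇒0≤y-x x≤y) 0≤z))

  0<x² : x # 0# → 0# < x * x
  0<x² {x} x#0 with #⇒<⊎> x#0
  ... | inj₂ 0<x = *-pos 0<x 0<x
  ... | inj₁ x<0 = <-≈-trans (*-pos 0<-x 0<-x)
    (solve 1 (λ x → (:0 :- x) :* (:0 :- x) := x :* x) refl x)
    where 0<-x = x<y⇒0<y-x x<0

  0≤x² : ∀ x → 0# ≤ x * x
  0≤x² x x²<0 = ¬¬#⊎≈ x 0#
    [ (λ x#0 → <⇒≤ (0<x² x#0) x²<0)
    , (λ x≈0 → <-irrefl (trans (*-congˡ x≈0) (zeroʳ x)) x²<0) ]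

  fromℕ-mono : ∀ {m n} → m ℕ.≤ n → fromℕ m ≤ fromℕ n
  fromℕ-mono {n = n} ℕ.z≤n = nonneg n
    where
    nonneg : ∀ n → 0# ≤ fromℕ n
    nonneg zero    = ≈⇒≤ refl
    nonneg (suc n) = +-nonneg (<⇒≤ 0<1) (nonneg n)
  fromℕ-mono (ℕ.s≤s m≤n) = +-mono-≤ (≈⇒≤ refl) (fromℕ-mono m≤n)



  sum-mono : ∀ {n} {f g : Fin n → Carrier} → (∀ i → f i ≤ g i) → sum f ≤ sum g
  sum-mono {zero}  f≤g = ≈⇒≤ refl
  sum-mono {suc n} f≤g = +-mono-≤ (f≤g Fin.zero) (sum-mono (f≤g ∘ Fin.suc))

  sum-zero : ∀ {n} {f : Fin n → Carrier} → (∀ i → f i ≈ 0#) → sum f ≈ 0#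
  sum-zero {zero}  f≈0 = refl
  sum-zero {suc n} f≈0 = trans (+-cong (f≈0 Fin.zero) (sum-zero (f≈0 ∘ Fin.suc))) (+-identityˡ 0#)

-- The determinant as an alternating multilinear form of the rows.

module Determinants {c ℓ₁ ℓ₂ : Level} (ℝ : RealNumbers c ℓ₁ ℓ₂) where
  open RealNumbers ℝ hiding (zero)
  open LinearAlgebra ℝ
  open OrderedField ℝ
  open CommutativeRing commutativeRing using (semiring)
  open Sums semiring
    using (∑-distrib-+; *-distribˡ-sum; sum-cong-≋; sum-remove)
  open SetoidReasoning setoid

  infix 4 _≋_
  _≋_ : ∀ {n} → (Fin n → Carrier) → (Fin n → Carrier) → Set ℓ₁
  u ≋ v = ∀ i → u i ≈ v i

  one : ∀ {m} → Matrix m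
  one = scalar 1#

  mul : ∀ {m} → Matrix m → Matrix m → Matrix m
  mul A B i j = sum λ k → A i k * B k j

  scalar-≡ : ∀ {m} x (i : Fin m) → scalar x i i ≡ x
  scalar-≡ x i = ≡.cong (if_then x else 0#) (dec-true (i Fin.≟ i) ≡.refl)

  scalar-≢ : ∀ {m} x {i j : Fin m} → i ≢ j → scalar x i j ≡ 0#
  scalar-≢ x {i} {j} i≢j = ≡.cong (if_then x else 0#) (dec-false (i Fin.≟ j) i≢j)

  sum-scalarˡ : ∀ {m} x (i : Fin m) (v : Fin m → Carrier) → (sum λ j → scalar x i j * v j) ≈ x * v i
  sum-scalarˡ {suc m} x i v = begin
    (sum λ j → scalar x i j * v j)
      ≈⟨ sum-remove {i = i} (λ j → scalar x i j * v j) ⟩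
    scalar x i i * v i + (sum λ j → scalar x i (punchIn i j) * v (punchIn i j))
      ≈⟨ +-cong (*-congʳ (reflexive (scalar-≡ x i))) (sum-zero λ j →
           trans (*-congʳ (reflexive (scalar-≢ x (Finₚ.punchInᵢ≢i i j ∘ ≡.sym)))) (zeroˡ _)) ⟩
    x * v i + 0#
      ≈⟨ +-identityʳ _ ⟩
    x * v i ∎

  punchIn-cases : ∀ {p m} (P : Fin (suc m) → Set p) j → P j → (∀ k → P (punchIn j k)) → ∀ k → P k
  punchIn-cases P j Pj Ppunch k with j Fin.≟ k
  ... | yes ≡.refl = Pj
  ... | no j≢k = ≡.subst P (Finₚ.punchIn-punchOut j≢k) (Ppunch (Fin.punchOut j≢k))

  sum-linear : ∀ {n} a b (f g : Fin n → Carrier) →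
    (sum λ i → a * f i + b * g i) ≈ a * sum f + b * sum g
  sum-linear a b f g = begin
    (sum λ i → a * f i + b * g i)
      ≈⟨ ∑-distrib-+ (λ i → a * f i) (λ i → b * g i) ⟩
    (sum λ i → a * f i) + (sum λ i → b * g i)
      ≈⟨ +-cong (*-distribˡ-sum a f) (*-distribˡ-sum b g) ⟨
    a * sum f + b * sum g ∎

  -- Linearity relates three matrices that agree up to `≈` outside row `i`, so it applies to rows
  -- known only up to pointwise equality. Additivity and homogeneity are one law.
  record IsAlternatingForm {m} (F : Matrix m → Carrier) : Set (c ⊔ ℓ₁) where
    field
      cong        : ∀ {M N} → (∀ i → M i ≋ N i) → F M ≈ F N
      linear      : ∀ i a b {L} M N →
                    (∀ k → k ≢ i → L k ≋ M k) → (∀ k → k ≢ i → L k ≋ N k) →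
                    (∀ j → L i j ≈ a * M i j + b * N i j) →
                    F L ≈ a * F M + b * F N
      alternating : ∀ {i j M} → i ≢ j → M i ≋ M j → F M ≈ 0#

    -- By linearity in row `i` the two values differ by `a` times the value at a matrix whose rows
    -- `i` and `j` coincide.
    shear : ∀ {i j} → i ≢ j → ∀ a {L M} → (∀ k → k ≢ i → L k ≋ M k) →
            (∀ k → L i k ≈ M i k + a * M j k) → F L ≈ F M
    shear {i} {j} i≢j a {L} {M} rest row = begin
      F L                    ≈⟨ linear i 1# a M N rest
                                  (λ k k≢i l → trans (rest k k≢i l) (sym (reflexive (≡.cong (_$ l) (N-rest k k≢i)))))
                                  (λ l → trans (row l) (+-cong (sym (*-identityˡ _))
                                    (*-congˡ (sym (reflexive (≡.cong (_$ l) N-row)))))) ⟩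
      1# * F M + a * F N     ≈⟨ +-congˡ (*-congˡ (alternating i≢j λ l →
                                  reflexive (≡.cong (_$ l) (≡.trans N-row (≡.sym (N-rest j (i≢j ∘ ≡.sym))))))) ⟩
      1# * F M + a * 0#      ≈⟨ solve 2 (λ x a → :1 :* x :+ a :* :0 := x) refl (F M) a ⟩
      F M                    ∎
      where
      N : Matrix m
      N = updateAt M i (const (M j))

      N-row : N i ≡ M j
      N-row = Vectorₚ.updateAt-updates i M

      N-rest : ∀ k → k ≢ i → N k ≡ M k
      N-rest k = Vectorₚ.updateAt-minimal k i M

    -- An interchange consists of three shears and a change of sign in one row: the rows (u, v) of
    -- `M` become (u + v, v), (u + v, -u), (v, -u) and finally (v, u). The calculation runs through
    -- this list backwards.
    swap : ∀ {i j} → i ≢ j → ∀ {L M} → (∀ k → k ≢ i → k ≢ j → L k ≋ M k) →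
           L i ≋ M j → L j ≋ M i → F L ≈ - F M
    swap {i} {j} i≢j {L} {M} rest Li Lj = begin
      F L
        -- Scaling a single row is linearity with second coefficient 0, the same matrix filling both
        -- places.
        ≈⟨ linear j (- 1#) 0# (at v -u) (at v -u) (λ k k≢j l → L-rest k k≢j l) (λ k k≢j l → L-rest k k≢j l)
             (λ l → trans (Lj l) (trans
               (solve 1 (λ x → x := (:- :1) :* ((:- :1) :* x) :+ :0 :* ((:- :1) :* x)) refl (u l))
               (sym (reflexive (≡.cong (λ w → (- 1#) * w l + 0# * w l) at-j))))) ⟩
      (- 1#) * F (at v -u) + 0# * F (at v -u)
        ≈⟨ solve 1 (λ x → (:- :1) :* x :+ :0 :* x := :- x) refl (F (at v -u)) ⟩
      - F (at v -u)
        ≈⟨ -‿cong (shear i≢j 1# (λ k k≢i → change-i k k≢i) λ l → begin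
             at v -u i l                          ≡⟨ ≡.cong (_$ l) at-i ⟩
             v l
               ≈⟨ solve 2 (λ x y → y := (x :+ y) :+ :1 :* ((:- :1) :* x)) refl (u l) (v l) ⟩
             u+v l + 1# * -u l                    ≡⟨ ≡.cong₂ (λ x y → x l + 1# * y l) at-i at-j ⟨
             at u+v -u i l + 1# * at u+v -u j l   ∎) ⟩
      - F (at u+v -u)
        ≈⟨ -‿cong (shear (i≢j ∘ ≡.sym) (- 1#) (λ k k≢j → change-j k k≢j) λ l → begin
             at u+v -u j l                             ≡⟨ ≡.cong (_$ l) at-j ⟩
             -u l
               ≈⟨ solve 2 (λ x y → (:- :1) :* x := y :+ (:- :1) :* (x :+ y)) refl (u l) (v l) ⟩
             v l + (- 1#) * u+v l                      ≡⟨ ≡.cong₂ (λ x y → y l + (- 1#) * x l) at-i at-j ⟨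
             at u+v v j l + (- 1#) * at u+v v i l      ∎) ⟩
      - F (at u+v v)
        ≈⟨ -‿cong (shear i≢j 1# (λ k k≢i → M-rest k k≢i) λ l → begin
             at u+v v i l            ≡⟨ ≡.cong (_$ l) at-i ⟩
             u+v l                   ≈⟨ +-congˡ (*-identityˡ (v l)) ⟨
             u l + 1# * v l          ∎) ⟩
      - F M ∎
      where
      u v -u u+v : Fin m → Carrier
      u = M i
      v = M j
      -u l = (- 1#) * u l
      u+v l = u l + v l

      at : (p q : Fin m → Carrier) → Matrix m
      at p q = updateAt (updateAt M i (const p)) j (const q)

      at-i : ∀ {p q} → at p q i ≡ p
      at-i {p} = ≡.trans (Vectorₚ.updateAt-minimal i j _ i≢j) (Vectorₚ.updateAt-updates i M)

      at-j : ∀ {p q} → at p q j ≡ q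
      at-j {p} = Vectorₚ.updateAt-updates j (updateAt M i (const p))

      at-rest : ∀ {p q} k → k ≢ i → k ≢ j → at p q k ≡ M k
      at-rest k k≢i k≢j = ≡.trans (Vectorₚ.updateAt-minimal k j _ k≢j) (Vectorₚ.updateAt-minimal k i M k≢i)

      L-rest : ∀ k → k ≢ j → L k ≋ at v -u k
      L-rest k k≢j l with k Fin.≟ i
      ... | yes ≡.refl = trans (Li l) (reflexive (≡.sym (≡.cong (_$ l) at-i)))
      ... | no k≢i = trans (rest k k≢i k≢j l) (reflexive (≡.sym (≡.cong (_$ l) (at-rest k k≢i k≢j))))

      M-rest : ∀ {p} k → k ≢ i → at p v k ≋ M k
      M-rest k k≢i l with k Fin.≟ j
      ... | yes ≡.refl = reflexive (≡.cong (_$ l) at-j)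
      ... | no k≢j = reflexive (≡.cong (_$ l) (at-rest k k≢i k≢j))

      change-i : ∀ {p p′ q} k → k ≢ i → at p q k ≋ at p′ q k
      change-i k k≢i l with k Fin.≟ j
      ... | yes ≡.refl = reflexive (≡.cong (_$ l) (≡.trans at-j (≡.sym at-j)))
      ... | no k≢j = reflexive (≡.cong (_$ l) (≡.trans (at-rest k k≢i k≢j) (≡.sym (at-rest k k≢i k≢j))))

      change-j : ∀ {p q q′} k → k ≢ j → at p q k ≋ at p q′ k
      change-j k k≢j l with k Fin.≟ i
      ... | yes ≡.refl = reflexive (≡.cong (_$ l) (≡.trans at-i (≡.sym at-i)))
      ... | no k≢i = reflexive (≡.cong (_$ l) (≡.trans (at-rest k k≢i k≢j) (≡.sym (at-rest k k≢i k≢j))))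

  sign : ∀ {m} → Fin m → Carrier
  sign j = (- 1#) ^ toℕ j

  minor : ∀ {m} → Matrix (suc m) → Fin (suc m) → Matrix m
  minor M j k l = M (Fin.suc k) (punchIn j l)

  det-cong : ∀ {m} {M N : Matrix m} → (∀ i → M i ≋ N i) → det M ≈ det N
  det-cong {zero}  M≈N = refl
  det-cong {suc m} M≈N = sum-cong-≋ λ j →
    *-cong (*-congˡ {sign j} (M≈N Fin.zero j)) (det-cong λ k l → M≈N (Fin.suc k) (punchIn j l))

  det-linear : ∀ {m} i a b {L} (M N : Matrix m) →
    (∀ k → k ≢ i → L k ≋ M k) → (∀ k → k ≢ i → L k ≋ N k) →
    (∀ j → L i j ≈ a * M i j + b * N i j) → det L ≈ a * det M + b * det N
  det-linear {suc m} Fin.zero a b {L} M N L≈M L≈N row = begin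
    det L
      ≈⟨ (sum-cong-≋ λ j → begin
           sign j * L Fin.zero j * det (minor L j)
             ≈⟨ *-congʳ (*-congˡ (row j)) ⟩
           sign j * (a * M Fin.zero j + b * N Fin.zero j) * det (minor L j)
             ≈⟨ solve 6 (λ s a x b y d → s :* (a :* x :+ b :* y) :* d := a :* (s :* x :* d) :+ b :* (s :* y :* d))
                  refl (sign j) a (M Fin.zero j) b (N Fin.zero j) (det (minor L j)) ⟩
           a * (sign j * M Fin.zero j * det (minor L j)) + b * (sign j * N Fin.zero j * det (minor L j))
             ≈⟨ +-cong (*-congˡ (*-congˡ (det-cong λ k l → L≈M (Fin.suc k) (λ ()) (punchIn j l))))
                       (*-congˡ (*-congˡ (det-cong λ k l → L≈N (Fin.suc k) (λ ()) (punchIn j l)))) ⟩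
           a * (sign j * M Fin.zero j * det (minor M j)) + b * (sign j * N Fin.zero j * det (minor N j)) ∎) ⟩
    (sum λ j → a * (sign j * M Fin.zero j * det (minor M j)) + b * (sign j * N Fin.zero j * det (minor N j)))
      ≈⟨ sum-linear a b (λ j → sign j * M Fin.zero j * det (minor M j))
           (λ j → sign j * N Fin.zero j * det (minor N j)) ⟩
    a * det M + b * det N ∎
  det-linear {suc m} (Fin.suc i) a b {L} M N L≈M L≈N row = begin
    det L
      ≈⟨ (sum-cong-≋ λ j → begin
           sign j * L Fin.zero j * det (minor L j)
             ≈⟨ *-congˡ (det-linear i a b (minor M j) (minor N j)
                  (λ k k≢i l → L≈M (Fin.suc k) (k≢i ∘ Finₚ.suc-injective) (punchIn j l))
                  (λ k k≢i l → L≈N (Fin.suc k) (k≢i ∘ Finₚ.suc-injective) (punchIn j l))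
                  (λ l → row (punchIn j l))) ⟩
           sign j * L Fin.zero j * (a * det (minor M j) + b * det (minor N j))
             ≈⟨ solve 6 (λ s x a d b e → s :* x :* (a :* d :+ b :* e) := a :* (s :* x :* d) :+ b :* (s :* x :* e))
                  refl (sign j) (L Fin.zero j) a (det (minor M j)) b (det (minor N j)) ⟩
           a * (sign j * L Fin.zero j * det (minor M j)) + b * (sign j * L Fin.zero j * det (minor N j))
             ≈⟨ +-cong (*-congˡ (*-congʳ (*-congˡ (L≈M Fin.zero (λ ()) j))))
                       (*-congˡ (*-congʳ (*-congˡ (L≈N Fin.zero (λ ()) j)))) ⟩
           a * (sign j * M Fin.zero j * det (minor M j)) + b * (sign j * N Fin.zero j * det (minor N j)) ∎) ⟩
    (sum λ j → a * (sign j * M Fin.zero j * det (minor M j)) + b * (sign j * N Fin.zero j * det (minor N j)))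
      ≈⟨ sum-linear a b (λ j → sign j * M Fin.zero j * det (minor M j))
           (λ j → sign j * N Fin.zero j * det (minor N j)) ⟩
    a * det M + b * det N ∎

  -- The Laplace expansion of a determinant with equal first two rows u along
  -- these rows; Φ h stands for the minor on the columns in the image of h.
  -- The terms for the column pairs {0 , k + 1} cancel, and those avoiding
  -- column 0 form a sum of the same shape.
  double-expansion : ∀ m (u : Fin (2 ℕ.+ m) → Carrier) (Φ : (Fin m → Fin (2 ℕ.+ m)) → Carrier) →
    (∀ {g h} → (∀ i → g i ≡ h i) → Φ g ≈ Φ h) →
    (sum λ j → sign j * u j * sum λ k →
      sign k * u (punchIn j k) * Φ (λ l → punchIn j (punchIn k l))) ≈ 0#
  double-expansion m u Φ Φ-cong = begin
    (sum λ j → sign j * u j * sum λ k → term j k)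
      ≈⟨ +-cong (*-distribˡ-sum (1# * u Fin.zero) (term Fin.zero)) (begin
           (sum λ j → sign (Fin.suc j) * u (Fin.suc j) *
             (term (Fin.suc j) Fin.zero + sum λ k → term (Fin.suc j) (Fin.suc k)))
             ≈⟨ (sum-cong-≋ λ j → distribˡ (sign (Fin.suc j) * u (Fin.suc j))
                  (term (Fin.suc j) Fin.zero) (sum λ k → term (Fin.suc j) (Fin.suc k))) ⟩
           _ ≈⟨ ∑-distrib-+ (λ j → sign (Fin.suc j) * u (Fin.suc j) * term (Fin.suc j) Fin.zero)
                            (λ j → sign (Fin.suc j) * u (Fin.suc j) * sum λ k → term (Fin.suc j) (Fin.suc k)) ⟩
           _ ∎) ⟩
    sum first + (sum second + sum third)  ≈⟨ +-assoc _ _ _ ⟨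
    (sum first + sum second) + sum third  ≈⟨ +-congʳ (∑-distrib-+ first second) ⟨
    (sum λ k → first k + second k) + sum third
      ≈⟨ +-cong (sum-zero λ k →
           solve 4 (λ s u₀ uₖ φ → :1 :* u₀ :* (s :* uₖ :* φ) :+ (:- :1) :* s :* uₖ :* (:1 :* u₀ :* φ) := :0)
             refl (sign k) (u Fin.zero) (u (Fin.suc k)) (Φ (λ l → Fin.suc (punchIn k l))))
         (third-zero m u Φ Φ-cong) ⟩
    0# + 0#  ≈⟨ +-identityˡ 0# ⟩
    0# ∎
    where
    term : Fin (2 ℕ.+ m) → Fin (suc m) → Carrier
    term j k = sign k * u (punchIn j k) * Φ (λ l → punchIn j (punchIn k l))

    first second third : Fin (suc m) → Carrier
    first  k = 1# * u Fin.zero * term Fin.zero k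
    second j = sign (Fin.suc j) * u (Fin.suc j) * term (Fin.suc j) Fin.zero
    third  j = sign (Fin.suc j) * u (Fin.suc j) * sum λ k → term (Fin.suc j) (Fin.suc k)

    third-zero : ∀ m (u : Fin (2 ℕ.+ m) → Carrier) (Φ : (Fin m → Fin (2 ℕ.+ m)) → Carrier) →
      (∀ {g h} → (∀ i → g i ≡ h i) → Φ g ≈ Φ h) →
      (sum λ j → sign (Fin.suc j) * u (Fin.suc j) * sum λ k →
        sign (Fin.suc k) * u (punchIn (Fin.suc j) (Fin.suc k)) *
          Φ (λ l → punchIn (Fin.suc j) (punchIn (Fin.suc k) l))) ≈ 0#
    third-zero zero u Φ Φ-cong = sum-zero λ j → zeroʳ (sign (Fin.suc j) * u (Fin.suc j))
    third-zero (suc m) u Φ Φ-cong = begin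
      (sum λ j → sign (Fin.suc j) * u (Fin.suc j) * sum λ k →
        sign (Fin.suc k) * u (Fin.suc (punchIn j k)) * Φ (λ l → punchIn (Fin.suc j) (punchIn (Fin.suc k) l)))
        -- Every minor here keeps column 0, so this column is absorbed into `Φ′`; the two factors -1
        -- that come from shifting `j` and `k` by one cancel. What remains is a double expansion
        -- with one column fewer.
        ≈⟨ (sum-cong-≋ λ j → begin
             (- 1#) * sign j * u (Fin.suc j) * _
               ≈⟨ *-congˡ (sum-cong-≋ λ k → trans
                    (*-congˡ (Φ-cong {λ l → punchIn (Fin.suc j) (punchIn (Fin.suc k) l)}
                      {Fin.zero ∷ λ l → Fin.suc (punchIn j (punchIn k l))} (λ { Fin.zero → ≡.refl ; (Fin.suc l) → ≡.refl })))
                    (solve 3 (λ s x φ → (:- :1) :* s :* x :* φ := (:- :1) :* (s :* x :* φ)) refl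
                      (sign k) (u (Fin.suc (punchIn j k))) (Φ′ λ l → punchIn j (punchIn k l)))) ⟩
             (- 1#) * sign j * u (Fin.suc j) * (sum λ k → (- 1#) * inner j k)
               ≈⟨ *-congˡ (*-distribˡ-sum (- 1#) (inner j)) ⟨
             (- 1#) * sign j * u (Fin.suc j) * ((- 1#) * sum (inner j))
               ≈⟨ solve 3 (λ s x y → (:- :1) :* s :* x :* ((:- :1) :* y) := s :* x :* y) refl (sign j) (u (Fin.suc j)) _ ⟩
             sign j * u (Fin.suc j) * sum (inner j) ∎) ⟩
      _ ≈⟨ double-expansion m (u ∘ Fin.suc) Φ′
             (λ g≗h → Φ-cong (λ { Fin.zero → ≡.refl ; (Fin.suc i) → ≡.cong Fin.suc (g≗h i) })) ⟩
      0# ∎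
      where
      Φ′ : (Fin m → Fin (2 ℕ.+ m)) → Carrier
      Φ′ h = Φ (Fin.zero ∷ (Fin.suc ∘ h))

      inner : Fin (2 ℕ.+ m) → Fin (suc m) → Carrier
      inner j k = sign k * u (Fin.suc (punchIn j k)) * Φ′ λ l → punchIn j (punchIn k l)

  private
    first-two : ∀ {m} (M : Matrix (suc (suc m))) → M Fin.zero ≋ M (Fin.suc Fin.zero) → det M ≈ 0#
    first-two {m} M equal = begin
      det M
        ≈⟨ (sum-cong-≋ λ j → *-congˡ {sign j * M Fin.zero j} (sum-cong-≋ λ k →
             *-congʳ {det (minor (minor M j) k)} (*-congˡ {sign k} (sym (equal (punchIn j k)))))) ⟩
      _ ≈⟨ double-expansion m (M Fin.zero)
             (λ h → det λ k l → M (Fin.suc (Fin.suc k)) (h l))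
             (λ g≗h → det-cong λ k l → reflexive (≡.cong (M (Fin.suc (Fin.suc k))) (g≗h l))) ⟩
      0# ∎

    -- Counting rows from 0, an interchange of rows 1 and j + 2 takes place inside the minors of the
    -- expansion, where the smaller determinant is already known to be alternating. It moves the two
    -- equal rows to the top.
    zero-suc : ∀ {m} → IsAlternatingForm (det {m}) → ∀ j (M : Matrix (suc m)) →
      M Fin.zero ≋ M (Fin.suc j) → det M ≈ 0#
    zero-suc {suc m} minor-form Fin.zero    M equal = first-two M equal
    zero-suc {suc m} minor-form (Fin.suc j) M equal = begin
      det M
        ≈⟨ (sum-cong-≋ λ l → *-congˡ {sign l * M Fin.zero l}
             (IsAlternatingForm.swap minor-form {Fin.zero} {Fin.suc j} (λ ())
             {minor M l} {minor N l}
             (λ { Fin.zero 0≢0 _ → ⊥-elim (0≢0 ≡.refl)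
                ; (Fin.suc k) _ k≢j n → reflexive (≡.cong (_$ punchIn l n)
                    (≡.sym (Vectorₚ.updateAt-minimal k j _ (k≢j ∘ ≡.cong Fin.suc)))) })
             (λ n → reflexive (≡.cong (_$ punchIn l n)
               (≡.sym (Vectorₚ.updateAt-updates j (λ k → M (Fin.suc (Fin.suc k)))))))
             (λ n → refl))) ⟩
      (sum λ l → sign l * M Fin.zero l * - det (minor N l))
        ≈⟨ (sum-cong-≋ λ l → solve 3 (λ s x d → s :* x :* (:- d) := (:- :1) :* (s :* x :* d)) refl
             (sign l) (M Fin.zero l) (det (minor N l))) ⟩
      (sum λ l → (- 1#) * (sign l * M Fin.zero l * det (minor N l)))
        ≈⟨ *-distribˡ-sum (- 1#) (λ l → sign l * M Fin.zero l * det (minor N l)) ⟨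
      (- 1#) * det N
        ≈⟨ *-congˡ (first-two N equal) ⟩
      (- 1#) * 0#
        ≈⟨ zeroʳ (- 1#) ⟩
      0# ∎
      where
      N : Matrix (suc (suc m))
      N = M Fin.zero ∷ (M (Fin.suc (Fin.suc j)) ∷
        updateAt (λ k → M (Fin.suc (Fin.suc k))) j (const (M (Fin.suc Fin.zero))))

  -- Induction on the size: two equal rows below the first stay equal in every minor, and a pair
  -- containing the first row is left to `zero-suc`, which receives the induction hypothesis as an
  -- argument.
  det-isAlternatingForm : ∀ {m} → IsAlternatingForm (det {m})
  det-isAlternatingForm {zero} = record
    { cong = det-cong ; linear = det-linear ; alternating = λ { {()} } }
  det-isAlternatingForm {suc m} = record
    { cong = det-cong ; linear = det-linear ; alternating = alternating }
    where
    alternating : ∀ {i j M} → i ≢ j → M i ≋ M j → det {suc m} M ≈ 0#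
    alternating {Fin.zero}  {Fin.zero}  i≢j _ = ⊥-elim (i≢j ≡.refl)
    alternating {Fin.zero}  {Fin.suc j} {M} _ equal = zero-suc det-isAlternatingForm j M equal
    alternating {Fin.suc i} {Fin.zero}  {M} _ equal = zero-suc det-isAlternatingForm i M (sym ∘ equal)
    alternating {Fin.suc i} {Fin.suc j} {M} i≢j equal = sum-zero λ k →
      trans (*-congˡ {sign k * M Fin.zero k} (IsAlternatingForm.alternating det-isAlternatingForm
        (i≢j ∘ ≡.cong Fin.suc) (λ l → equal (punchIn k l)))) (zeroʳ _)

-- Uniqueness of alternating forms and multiplicativity of the determinant.

module Products {c ℓ₁ ℓ₂ : Level} (ℝ : RealNumbers c ℓ₁ ℓ₂) where
  open RealNumbers ℝ hiding (zero)
  open LinearAlgebra ℝ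
  open OrderedField ℝ
  open Determinants ℝ
  open CommutativeRing commutativeRing using (semiring)
  open HeytingProperties heytingCommutativeRing using (x-0≈x; 1#0; invertibleʳ⇒#; x#0y#0→xy#0)
  open Sums semiring
    using (∑-distrib-+; *-distribˡ-sum; *-distribʳ-sum; sum-cong-≋; sum-remove)
  open SetoidReasoning setoid

  scalar-sym : ∀ {m} x (i j : Fin m) → scalar x i j ≡ scalar x j i
  scalar-sym x i j with i Fin.≟ j
  ... | yes ≡.refl = ≡.sym (scalar-≡ x i)
  ... | no i≢j = ≡.sym (scalar-≢ x (i≢j ∘ ≡.sym))

  sum-scalarʳ : ∀ {m} x (i : Fin m) (v : Fin m → Carrier) → (sum λ j → v j * scalar x j i) ≈ v i * x
  sum-scalarʳ x i v = begin
    (sum λ j → v j * scalar x j i)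
      ≈⟨ (sum-cong-≋ λ j → trans (*-comm (v j) _) (*-congʳ (reflexive (scalar-sym x j i)))) ⟩
    (sum λ j → scalar x i j * v j)   ≈⟨ sum-scalarˡ x i v ⟩
    x * v i                          ≈⟨ *-comm x (v i) ⟩
    v i * x                          ∎

  private
    insertAt-cong : ∀ {m} {u v : Fin m → Carrier} j → u ≋ v → insertAt u j 0# ≋ insertAt v j 0#
    insertAt-cong {u = u} {v} j u≋v = punchIn-cases _ j
      (reflexive (≡.trans (Vectorₚ.insertAt-lookup u j 0#) (≡.sym (Vectorₚ.insertAt-lookup v j 0#))))
      (λ k → trans (reflexive (Vectorₚ.insertAt-punchIn u j 0# k))
        (trans (u≋v k) (reflexive (≡.sym (Vectorₚ.insertAt-punchIn v j 0# k)))))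

    insertAt-linear : ∀ {m} {u v w : Fin m → Carrier} j a b → (∀ k → w k ≈ a * u k + b * v k) →
      ∀ k → insertAt w j 0# k ≈ a * insertAt u j 0# k + b * insertAt v j 0# k
    insertAt-linear {u = u} {v} {w} j a b w≋ = punchIn-cases _ j
      (begin
        insertAt w j 0# j    ≡⟨ Vectorₚ.insertAt-lookup w j 0# ⟩
        0#                   ≈⟨ solve 2 (λ a b → :0 := a :* :0 :+ b :* :0) refl a b ⟩
        a * 0# + b * 0#
          ≡⟨ ≡.cong₂ (λ x y → a * x + b * y) (Vectorₚ.insertAt-lookup u j 0#) (Vectorₚ.insertAt-lookup v j 0#) ⟨
        a * insertAt u j 0# j + b * insertAt v j 0# j ∎)
      (λ k → begin
        insertAt w j 0# (punchIn j k)    ≡⟨ Vectorₚ.insertAt-punchIn w j 0# k ⟩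
        w k                              ≈⟨ w≋ k ⟩
        a * u k + b * v k
          ≡⟨ ≡.cong₂ (λ x y → a * x + b * y) (Vectorₚ.insertAt-punchIn u j 0# k) (Vectorₚ.insertAt-punchIn v j 0# k) ⟨
        a * insertAt u j 0# (punchIn j k) + b * insertAt v j 0# (punchIn j k) ∎)

    insertAt-one : ∀ {m} (j : Fin (suc m)) i → insertAt (one i) j 0# ≋ one (punchIn j i)
    insertAt-one j i = punchIn-cases _ j
      (reflexive (≡.trans (Vectorₚ.insertAt-lookup (one i) j 0#) (≡.sym (scalar-≢ 1# (Finₚ.punchInᵢ≢i j i)))))
      (λ k → reflexive (≡.trans (Vectorₚ.insertAt-punchIn (one i) j 0# k) (one-punchIn k)))
      where
      one-punchIn : ∀ k → one i k ≡ one (punchIn j i) (punchIn j k)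
      one-punchIn k with i Fin.≟ k
      ... | yes ≡.refl = ≡.sym (scalar-≡ 1# (punchIn j i))
      ... | no i≢k = ≡.sym (scalar-≢ 1# (i≢k ∘ Finₚ.punchIn-injective j i k))

    punchIn-inject₁ : ∀ {m} (i : Fin m) → punchIn (inject₁ i) i ≡ Fin.suc i
    punchIn-inject₁ Fin.zero    = ≡.refl
    punchIn-inject₁ (Fin.suc i) = ≡.cong Fin.suc (punchIn-inject₁ i)

    punchIn-suc : ∀ {m} (i : Fin m) → punchIn (Fin.suc i) i ≡ inject₁ i
    punchIn-suc Fin.zero    = ≡.refl
    punchIn-suc (Fin.suc i) = ≡.cong Fin.suc (punchIn-suc i)

    punchIn-suc-inject₁ : ∀ {m} {i k : Fin m} → k ≢ i → punchIn (Fin.suc i) k ≡ punchIn (inject₁ i) k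
    punchIn-suc-inject₁ {i = Fin.zero}  {Fin.zero}  k≢i = ⊥-elim (k≢i ≡.refl)
    punchIn-suc-inject₁ {i = Fin.zero}  {Fin.suc k} k≢i = ≡.refl
    punchIn-suc-inject₁ {i = Fin.suc i} {Fin.zero}  k≢i = ≡.refl
    punchIn-suc-inject₁ {i = Fin.suc i} {Fin.suc k} k≢i =
      ≡.cong Fin.suc (punchIn-suc-inject₁ (k≢i ∘ ≡.cong Fin.suc))

  module _ {m} {F : Matrix (suc m) → Carrier} (isForm : IsAlternatingForm F) where
    open IsAlternatingForm isForm

    -- The number `k` of terms is independent of the size of the matrix, so that the induction can
    -- remove one term at a time.
    expand-row : ∀ k (a : Fin k → Carrier) (v : Fin k → Fin (suc m) → Carrier) {L} T →
      (∀ i → L (Fin.suc i) ≋ T i) → (∀ j → L Fin.zero j ≈ sum λ l → a l * v l j) →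
      F L ≈ sum λ l → a l * F (v l ∷ T)
    expand-row zero a v {L} T rest row = begin
      F L
        -- An empty combination makes the first row zero, which is 0 times itself plus 0 times
        -- itself.
        ≈⟨ linear Fin.zero 0# 0# L L (λ _ _ _ → refl) (λ _ _ _ → refl)
             (λ j → trans (row j) (solve 1 (λ x → :0 := :0 :* x :+ :0 :* x) refl (L Fin.zero j))) ⟩
      0# * F L + 0# * F L
        ≈⟨ solve 1 (λ x → :0 :* x :+ :0 :* x := :0) refl (F L) ⟩
      0# ∎
    expand-row (suc k) a v {L} T rest row = begin
      F L
        ≈⟨ linear Fin.zero (a Fin.zero) 1# (v Fin.zero ∷ T) (w ∷ T)
             (λ { Fin.zero 0≢0 → ⊥-elim (0≢0 ≡.refl) ; (Fin.suc i) _ → rest i })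
             (λ { Fin.zero 0≢0 → ⊥-elim (0≢0 ≡.refl) ; (Fin.suc i) _ → rest i })
             (λ j → trans (row j) (+-congˡ (sym (*-identityˡ (w j))))) ⟩
      a Fin.zero * F (v Fin.zero ∷ T) + 1# * F (w ∷ T)
        ≈⟨ +-congˡ (trans (*-identityˡ _) (expand-row k (tail a) (tail v) T (λ i j → refl) (λ j → refl))) ⟩
      (sum λ l → a l * F (v l ∷ T)) ∎
      where
      w : Fin (suc m) → Carrier
      w j = sum λ l → a (Fin.suc l) * v (Fin.suc l) j

    shear-rows : ∀ u (a : Fin m → Carrier) {T′ T} → (∀ i j → T′ i j ≈ T i j + a i * u j) →
      F (u ∷ T′) ≈ F (u ∷ T)
    shear-rows u = go (λ T → F (u ∷ T))
      (λ T≋ → cong λ { Fin.zero _ → refl ; (Fin.suc i) → T≋ i })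
      (λ i a rest row → shear {Fin.suc i} {Fin.zero} (λ ()) a
        (λ { Fin.zero _ _ → refl ; (Fin.suc k) k≢i → rest k (k≢i ∘ ≡.cong Fin.suc) }) row)
      where
      -- The rows below `u` are treated one by one. `G` is the form with `u` and the rows already
      -- passed held fixed, and the recursion only has to know that `G` is unaffected by a single
      -- shear.
      go : ∀ {k} (G : (Fin k → Fin (suc m) → Carrier) → Carrier) →
        (∀ {T′ T} → (∀ i → T′ i ≋ T i) → G T′ ≈ G T) →
        (∀ i a {T′ T} → (∀ k → k ≢ i → T′ k ≋ T k) → (∀ j → T′ i j ≈ T i j + a * u j) → G T′ ≈ G T) →
        ∀ (a : Fin k → Carrier) {T′ T} → (∀ i j → T′ i j ≈ T i j + a i * u j) → G T′ ≈ G T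
      go {zero}  G G-cong G-shear a T′≋ = G-cong λ ()
      go {suc k} G G-cong G-shear a {T′} {T} T′≋ = begin
        G T′
          ≈⟨ G-cong (λ { Fin.zero _ → refl ; (Fin.suc i) _ → refl }) ⟩
        G (T′ Fin.zero ∷ tail T′)
          ≈⟨ go (λ S → G (T′ Fin.zero ∷ S))
               (λ S≋ → G-cong λ { Fin.zero _ → refl ; (Fin.suc i) → S≋ i })
               (λ i a rest row → G-shear (Fin.suc i) a
                 (λ { Fin.zero _ _ → refl ; (Fin.suc k) k≢i → rest k (k≢i ∘ ≡.cong Fin.suc) }) row)
               (tail a) (λ i → T′≋ (Fin.suc i)) ⟩
        G (T′ Fin.zero ∷ tail T)
          ≈⟨ G-shear Fin.zero (a Fin.zero)
               (λ { Fin.zero 0≢0 → ⊥-elim (0≢0 ≡.refl) ; (Fin.suc i) _ _ → refl }) (T′≋ Fin.zero) ⟩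
        G T ∎

    border : Fin (suc m) → Matrix m → Matrix (suc m)
    border j N = one j ∷ λ i → insertAt (N i) j 0#

    -- Multiples of the first row e_j clear column `j` of all other rows, so only the entries
    -- outside this column matter.
    border-minor : ∀ j T → F (one j ∷ T) ≈ F (border j λ i k → T i (punchIn j k))
    border-minor j T = sym (shear-rows (one j) (λ i → - T i j) λ i → punchIn-cases _ j
      (begin
        insertAt (T i ∘ punchIn j) j 0# j    ≡⟨ Vectorₚ.insertAt-lookup (T i ∘ punchIn j) j 0# ⟩
        0#                                   ≈⟨ solve 1 (λ x → :0 := x :+ (:- x) :* :1) refl (T i j) ⟩
        T i j + - T i j * 1#                 ≡⟨ ≡.cong (λ x → T i j + - T i j * x) (scalar-≡ 1# j) ⟨
        T i j + - T i j * one j j            ∎)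
      (λ k → begin
        insertAt (T i ∘ punchIn j) j 0# (punchIn j k)    ≡⟨ Vectorₚ.insertAt-punchIn (T i ∘ punchIn j) j 0# k ⟩
        T i (punchIn j k)
          ≈⟨ solve 2 (λ x y → x := x :+ (:- y) :* :0) refl (T i (punchIn j k)) (T i j) ⟩
        T i (punchIn j k) + - T i j * 0#
          ≡⟨ ≡.cong (λ x → T i (punchIn j k) + - T i j * x) (scalar-≢ 1# (Finₚ.punchInᵢ≢i j k ∘ ≡.sym)) ⟨
        T i (punchIn j k) + - T i j * one j (punchIn j k) ∎))

    border-isAlternatingForm : ∀ j → IsAlternatingForm (F ∘ border j)
    border-isAlternatingForm j = record
      { cong = λ M≋N → cong λ { Fin.zero _ → refl ; (Fin.suc i) → insertAt-cong j (M≋N i) }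
      ; linear = λ i a b M N L≋M L≋N row → linear (Fin.suc i) a b (border j M) (border j N)
          (λ { Fin.zero _ _ → refl ; (Fin.suc k) k≢i → insertAt-cong j (L≋M k (k≢i ∘ ≡.cong Fin.suc)) })
          (λ { Fin.zero _ _ → refl ; (Fin.suc k) k≢i → insertAt-cong j (L≋N k (k≢i ∘ ≡.cong Fin.suc)) })
          (insertAt-linear j a b row)
      ; alternating = λ {i} {k} i≢k equal → alternating {Fin.suc i} {Fin.suc k}
          (i≢k ∘ Finₚ.suc-injective) (insertAt-cong j equal)
      }

    -- The rows form the identity matrix with e_j moved to the top, a cycle of j + 1 rows. Passing
    -- from j to j + 1 interchanges the first row with one other row, at the cost of one factor -1.
    border-one : ∀ j → F (border j one) ≈ sign j * F one
    border-one j = begin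
      F (border j one)
        ≈⟨ cong (λ { Fin.zero _ → refl ; (Fin.suc i) → insertAt-one j i }) ⟩
      F (one j ∷ λ i → one (punchIn j i))
        ≈⟨ <-weakInduction (λ j → F (one j ∷ λ i → one (punchIn j i)) ≈ sign j * F one)
             (trans (cong λ { Fin.zero _ → refl ; (Fin.suc i) _ → refl }) (sym (*-identityˡ _)))
             step j ⟩
      sign j * F one ∎
      where
      step : ∀ i → F (one (inject₁ i) ∷ λ k → one (punchIn (inject₁ i) k)) ≈ sign (inject₁ i) * F one →
             F (one (Fin.suc i) ∷ λ k → one (punchIn (Fin.suc i) k)) ≈ sign (Fin.suc i) * F one
      step i ih = begin
        F (one (Fin.suc i) ∷ λ k → one (punchIn (Fin.suc i) k))
          ≈⟨ swap {Fin.zero} {Fin.suc i} (λ ())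
               (λ { Fin.zero 0≢0 _ → ⊥-elim (0≢0 ≡.refl)
                  ; (Fin.suc k) _ k≢i l → reflexive (≡.cong (λ x → one x l)
                      (punchIn-suc-inject₁ (k≢i ∘ ≡.cong Fin.suc))) })
               (λ l → reflexive (≡.cong (λ x → one x l) (≡.sym (punchIn-inject₁ i))))
               (λ l → reflexive (≡.cong (λ x → one x l) (punchIn-suc i))) ⟩
        - F (one (inject₁ i) ∷ λ k → one (punchIn (inject₁ i) k))
          ≈⟨ -‿cong ih ⟩
        - (sign (inject₁ i) * F one)
          ≡⟨ ≡.cong (λ k → - ((- 1#) ^ k * F one)) (Finₚ.toℕ-inject₁ i) ⟩
        - (sign i * F one)
          ≈⟨ solve 2 (λ s x → :- (s :* x) := (:- :1) :* s :* x) refl (sign i) (F one) ⟩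
        sign (Fin.suc i) * F one ∎

  -- After the first row has been expanded in unit vectors, each term is an alternating form of a
  -- minor, to which the induction hypothesis applies; the sum that results is the Laplace
  -- expansion.
  det-unique : ∀ {m} {F : Matrix m → Carrier} → IsAlternatingForm F → ∀ M → F M ≈ det M * F one
  det-unique {zero} isForm M = trans (IsAlternatingForm.cong isForm λ ()) (sym (*-identityˡ _))
  det-unique {suc m} {F} isForm M = begin
    F M
      ≈⟨ expand-row isForm (suc m) (M Fin.zero) one (tail M) (λ _ _ → refl)
           (λ j → sym (trans (sum-scalarʳ 1# j (M Fin.zero)) (*-identityʳ _))) ⟩
    (sum λ j → M Fin.zero j * F (one j ∷ tail M))
      ≈⟨ (sum-cong-≋ λ j → begin
           M Fin.zero j * F (one j ∷ tail M)
             ≈⟨ *-congˡ (border-minor isForm j (tail M)) ⟩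
           M Fin.zero j * F (border isForm j (minor M j))
             ≈⟨ *-congˡ (det-unique (border-isAlternatingForm isForm j) (minor M j)) ⟩
           M Fin.zero j * (det (minor M j) * F (border isForm j one))
             ≈⟨ *-congˡ (*-congˡ (border-one isForm j)) ⟩
           M Fin.zero j * (det (minor M j) * (sign j * F one))
             ≈⟨ solve 4 (λ x d s f → x :* (d :* (s :* f)) := s :* x :* d :* f) refl
                  (M Fin.zero j) (det (minor M j)) (sign j) (F one) ⟩
           sign j * M Fin.zero j * det (minor M j) * F one ∎) ⟩
    (sum λ j → sign j * M Fin.zero j * det (minor M j) * F one)
      ≈⟨ *-distribʳ-sum (F one) (λ j → sign j * M Fin.zero j * det (minor M j)) ⟨
    det M * F one ∎

  -- For fixed `B`, the determinant of the product is an alternating form of the rows of `A`, and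
  -- its value at the identity is `det B`.
  det-mul : ∀ {m} (A B : Matrix m) → det (mul A B) ≈ det A * det B
  det-mul {m} A B = begin
    det (mul A B)          ≈⟨ det-unique isForm A ⟩
    det A * det (mul one B)
      ≈⟨ *-congˡ (det-cong λ i j → trans (sum-scalarˡ 1# i (λ k → B k j)) (*-identityˡ (B i j))) ⟩
    det A * det B          ∎
    where
    isForm : IsAlternatingForm (λ A → det (mul A B))
    isForm = record
      { cong = λ M≋N → det-cong λ i j → sum-cong-≋ λ k → *-congʳ (M≋N i k)
      ; linear = λ i a b {L} M N L≋M L≋N row → det-linear i a b (mul M B) (mul N B)
          (λ k k≢i j → sum-cong-≋ λ l → *-congʳ (L≋M k k≢i l))
          (λ k k≢i j → sum-cong-≋ λ l → *-congʳ (L≋N k k≢i l))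
          (λ j → begin
            (sum λ k → L i k * B k j)
              ≈⟨ (sum-cong-≋ λ k → trans (*-congʳ (row k))
                   (solve 5 (λ a x b y z → (a :* x :+ b :* y) :* z := a :* (x :* z) :+ b :* (y :* z)) refl
                     a (M i k) b (N i k) (B k j))) ⟩
            (sum λ k → a * (M i k * B k j) + b * (N i k * B k j))
              ≈⟨ sum-linear a b (λ k → M i k * B k j) (λ k → N i k * B k j) ⟩
            a * mul M B i j + b * mul N B i j ∎)
      ; alternating = λ {i} {j} i≢j equal → IsAlternatingForm.alternating det-isAlternatingForm i≢j
          (λ l → sum-cong-≋ λ k → *-congʳ (equal k))
      }

  det-pivot : ∀ {m} (M : Matrix (suc m)) k → (∀ l → M Fin.zero (punchIn k l) ≈ 0#) →
    det M ≈ sign k * M Fin.zero k * det (minor M k)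
  det-pivot M k zeros = begin
    det M
      ≈⟨ sum-remove {i = k} (λ j → sign j * M Fin.zero j * det (minor M j)) ⟩
    sign k * M Fin.zero k * det (minor M k) + _
      ≈⟨ +-congˡ (sum-zero λ l → trans (*-congʳ (trans (*-congˡ {sign (punchIn k l)} (zeros l)) (zeroʳ _)))
           (zeroˡ (det (minor M (punchIn k l))))) ⟩
    sign k * M Fin.zero k * det (minor M k) + 0#
      ≈⟨ +-identityʳ _ ⟩
    sign k * M Fin.zero k * det (minor M k) ∎

  unit⇒#0 : ∀ {x y} → x * y ≈ 1# → x # 0#
  unit⇒#0 {x} {y} xy≈1 = invertibleʳ⇒# (y , trans (*-congʳ (x-0≈x x)) xy≈1)

  sign#0 : ∀ {m} (j : Fin m) → sign j # 0#
  sign#0 j = unit⇒#0 (go (toℕ j))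
    where
    go : ∀ n → (- 1#) ^ n * (- 1#) ^ n ≈ 1#
    go zero    = *-identityˡ 1#
    go (suc n) = trans (solve 1 (λ s → (:- :1) :* s :* ((:- :1) :* s) := s :* s) refl ((- 1#) ^ n)) (go n)

  -- Kernels of wide and of singular matrices.

  apply : ∀ {m n} → (Fin m → Fin n → Carrier) → (Fin n → Carrier) → Fin m → Carrier
  apply M v i = sum λ j → M i j * v j

  -- A coordinate apart from 0 is demanded, rather than a vector that is merely not zero, because it
  -- is what makes the norm positive.
  HasKernel : ∀ {m n} → (Fin m → Fin n → Carrier) → Set (c ⊔ ℓ₁ ⊔ ℓ₂)
  HasKernel M = ∃[ v ] (∃[ k ] v k # 0#) × (∀ i → apply M v i ≈ 0#)

  module Elimination {m n} (M : Fin (suc m) → Fin (suc n) → Carrier) (k : Fin (suc n))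
                     (p⁻¹ : Carrier) (pp⁻¹≈1 : M Fin.zero k * p⁻¹ ≈ 1#) where

    multiplier : Fin n → Carrier
    multiplier l = - (M Fin.zero (punchIn k l) * p⁻¹)

    cleared : ∀ l → M Fin.zero (punchIn k l) + M Fin.zero k * multiplier l ≈ 0#
    cleared l = begin
      M Fin.zero (punchIn k l) + M Fin.zero k * - (M Fin.zero (punchIn k l) * p⁻¹)
        ≈⟨ solve 3 (λ x p q → x :+ p :* (:- (x :* q)) := x :- (p :* q) :* x) refl
             (M Fin.zero (punchIn k l)) (M Fin.zero k) p⁻¹ ⟩
      M Fin.zero (punchIn k l) - (M Fin.zero k * p⁻¹) * M Fin.zero (punchIn k l)
        ≈⟨ +-congˡ (-‿cong (*-congʳ pp⁻¹≈1)) ⟩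
      M Fin.zero (punchIn k l) - 1# * M Fin.zero (punchIn k l)
        ≈⟨ solve 1 (λ x → x :- :1 :* x := :0) refl (M Fin.zero (punchIn k l)) ⟩
      0# ∎

    -- The Schur complement of the pivot: what is left below the first row once multiples of column
    -- `k` have cleared that row.
    schur : Fin m → Fin n → Carrier
    schur i l = M (Fin.suc i) (punchIn k l) + M (Fin.suc i) k * multiplier l

    lift-kernel : HasKernel schur → HasKernel M
    lift-kernel (w , (l , wl#0) , ker) = v , (punchIn k l , ≡.subst (_# 0#) (≡.sym (v-punchIn l)) wl#0) , v-ker
      where
      -- The coordinate at the pivot that the first equation forces when the others are given by
      -- `w`.
      t : Carrier
      t = sum λ l → multiplier l * w l

      v : Fin (suc n) → Carrier
      v = insertAt w k t

      v-punchIn : ∀ l → v (punchIn k l) ≡ w l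
      v-punchIn = Vectorₚ.insertAt-punchIn w k t

      apply-v : ∀ i → apply M v i ≈ sum λ l → (M i (punchIn k l) + M i k * multiplier l) * w l
      apply-v i = begin
        apply M v i
          ≈⟨ sum-remove {i = k} (λ j → M i j * v j) ⟩
        M i k * v k + (sum λ l → M i (punchIn k l) * v (punchIn k l))
          ≈⟨ +-cong (*-congˡ (reflexive (Vectorₚ.insertAt-lookup w k t)))
                    (sum-cong-≋ λ l → *-congˡ (reflexive (v-punchIn l))) ⟩
        M i k * t + (sum λ l → M i (punchIn k l) * w l)
          ≈⟨ +-congʳ (*-distribˡ-sum (M i k) (λ l → multiplier l * w l)) ⟩
        (sum λ l → M i k * (multiplier l * w l)) + (sum λ l → M i (punchIn k l) * w l)
          ≈⟨ ∑-distrib-+ (λ l → M i k * (multiplier l * w l)) (λ l → M i (punchIn k l) * w l) ⟨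
        (sum λ l → M i k * (multiplier l * w l) + M i (punchIn k l) * w l)
          ≈⟨ (sum-cong-≋ λ l → solve 4 (λ a b x w → a :* (b :* w) :+ x :* w := (x :+ a :* b) :* w) refl
               (M i k) (multiplier l) (M i (punchIn k l)) (w l)) ⟩
        (sum λ l → (M i (punchIn k l) + M i k * multiplier l) * w l) ∎

      v-ker : ∀ i → apply M v i ≈ 0#
      v-ker Fin.zero    = trans (apply-v Fin.zero) (sum-zero λ l → trans (*-congʳ (cleared l)) (zeroˡ (w l)))
      v-ker (Fin.suc i) = trans (apply-v (Fin.suc i)) (ker i)

  -- Induction on the number of equations: a pivot in the first row removes one equation and one
  -- unknown. Whether there is a pivot cannot be decided, so the excluded middle is used under the
  -- double negation.
  wide⇒¬¬kernel : ∀ {m} (M : Fin m → Fin (suc m) → Carrier) → ¬ ¬ HasKernel M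
  wide⇒¬¬kernel {zero} M no-kernel = no-kernel ((λ _ → 1#) , (Fin.zero , 1#0) , λ ())
  wide⇒¬¬kernel {suc m} M no-kernel = ¬¬-excluded-middle {A = ∃[ k ] M Fin.zero k # 0#} λ
    { (yes (k , pivot)) → let p⁻¹ , pp⁻¹≈1 = inverse pivot
                              open Elimination M k p⁻¹ pp⁻¹≈1
                          in wide⇒¬¬kernel schur (no-kernel ∘ lift-kernel)
    -- By tightness the first row vanishes and imposes no condition; one unknown is set to 0 to
    -- restore the surplus of exactly one.
    ; (no zeros) → wide⇒¬¬kernel (λ i j → M (Fin.suc i) (Fin.suc j)) λ { (w , (k , wk#0) , ker) →
        no-kernel (0# ∷ w , (Fin.suc k , wk#0) , λ
          { Fin.zero    → sum-zero λ j → trans (*-congʳ (¬#⇒≈ λ M0j#0 → zeros (j , M0j#0))) (zeroˡ ((0# ∷ w) j))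
          ; (Fin.suc i) → trans (+-cong (zeroʳ _) (ker i)) (+-identityˡ 0#) }) } }

  -- With a pivot, the determinant of the Schur complement vanishes too and the size drops. Without
  -- one, the first row is zero and the remaining rows form a wide system.
  det≈0⇒¬¬kernel : ∀ {m} (M : Matrix m) → det M ≈ 0# → ¬ ¬ HasKernel M
  det≈0⇒¬¬kernel {zero} M 1≈0 = ⊥-elim (#-irrefl 1≈0 1#0)
  det≈0⇒¬¬kernel {suc m} M det≈0 no-kernel = ¬¬-excluded-middle {A = ∃[ k ] M Fin.zero k # 0#} λ
    { (yes (k , pivot)) → let p⁻¹ , pp⁻¹≈1 = inverse pivot
                              open Elimination M k p⁻¹ pp⁻¹≈1
                          in det≈0⇒¬¬kernel schur (det-schur k pivot p⁻¹ pp⁻¹≈1) (no-kernel ∘ lift-kernel)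
    ; (no zeros) → wide⇒¬¬kernel (tail M) λ { (v , nonzero , ker) →
        no-kernel (v , nonzero , λ
          { Fin.zero    → sum-zero λ j → trans (*-congʳ (¬#⇒≈ λ M0j#0 → zeros (j , M0j#0))) (zeroˡ (v j))
          ; (Fin.suc i) → ker i }) } }
    where
    -- Right multiplication by `P` performs the column operations. Expanding `det (mul M P)` along
    -- its cleared first row gives sign times pivot times the determinant of the Schur complement,
    -- whereas by multiplicativity it is a multiple of `det M`.
    det-schur : ∀ k → M Fin.zero k # 0# → ∀ p⁻¹ pp⁻¹≈1 → det (Elimination.schur M k p⁻¹ pp⁻¹≈1) ≈ 0#
    det-schur k pivot p⁻¹ pp⁻¹≈1 = cancel-*ˡ (x#0y#0→xy#0 (sign#0 k) pivot) (begin
      sign k * M Fin.zero k * det schur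
        ≈⟨ *-cong (*-congˡ (sym MP-k)) (det-cong λ i l → sym (MP-punchIn (Fin.suc i) l)) ⟩
      sign k * mul M P Fin.zero k * det (minor (mul M P) k)
        ≈⟨ det-pivot (mul M P) k (λ l → trans (MP-punchIn Fin.zero l) (cleared l)) ⟨
      det (mul M P)        ≈⟨ det-mul M P ⟩
      det M * det P        ≈⟨ *-congʳ det≈0 ⟩
      0# * det P           ≈⟨ zeroˡ (det P) ⟩
      0#                   ≈⟨ zeroʳ _ ⟨
      sign k * M Fin.zero k * 0# ∎)
      where
      open Elimination M k p⁻¹ pp⁻¹≈1

      -- The entry 0 in position `k` leaves the pivot column itself unchanged.
      row : Fin (suc m) → Carrier
      row = insertAt multiplier k 0#

      P : Matrix (suc m)
      P i j = one i j + one k i * row j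

      MP : ∀ i j → mul M P i j ≈ M i j + M i k * row j
      MP i j = begin
        (sum λ l → M i l * (one l j + one k l * row j))
          ≈⟨ (sum-cong-≋ λ l → solve 4 (λ x a b y → x :* (a :+ b :* y) := x :* a :+ b :* (x :* y)) refl
               (M i l) (one l j) (one k l) (row j)) ⟩
        (sum λ l → M i l * one l j + one k l * (M i l * row j))
          ≈⟨ ∑-distrib-+ (λ l → M i l * one l j) (λ l → one k l * (M i l * row j)) ⟩
        (sum λ l → M i l * one l j) + (sum λ l → one k l * (M i l * row j))
          ≈⟨ +-cong (trans (sum-scalarʳ 1# j (M i)) (*-identityʳ _))
                    (trans (sum-scalarˡ 1# k (λ l → M i l * row j)) (*-identityˡ _)) ⟩
        M i j + M i k * row j ∎

      MP-k : mul M P Fin.zero k ≈ M Fin.zero k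
      MP-k = trans (MP Fin.zero k) (trans
        (+-congˡ (trans (*-congˡ (reflexive (Vectorₚ.insertAt-lookup multiplier k 0#))) (zeroʳ _))) (+-identityʳ _))

      MP-punchIn : ∀ i l → mul M P i (punchIn k l) ≈ M i (punchIn k l) + M i k * multiplier l
      MP-punchIn i l = trans (MP i (punchIn k l))
        (+-congˡ (*-congˡ (reflexive (Vectorₚ.insertAt-punchIn multiplier k 0# l))))

-- Polynomial functions.

module Polynomials {c ℓ₁ ℓ₂ : Level} (ℝ : RealNumbers c ℓ₁ ℓ₂) where
  open RealNumbers ℝ hiding (zero)
  open LinearAlgebra ℝ
  open OrderedField ℝ
  open Determinants ℝ
  open CommutativeRing commutativeRing using (semiring)
  open SetoidReasoning setoid

  -- Polynomial functions of degree less than n, without coefficients.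
  IsPolynomial : ℕ → (Carrier → Carrier) → Set (c ⊔ ℓ₁)
  IsPolynomial zero    f = Lift c (∀ x → f x ≈ 0#)
  IsPolynomial (suc n) f = ∀ t → ∃[ q ] IsPolynomial n q × (∀ x → f x - f t ≈ (x - t) * q x)

  polynomial-cong : ∀ n {f g} → (∀ x → f x ≈ g x) → IsPolynomial n f → IsPolynomial n g
  polynomial-cong zero    f≗g (lift f≈0) = lift λ x → trans (sym (f≗g x)) (f≈0 x)
  polynomial-cong (suc n) f≗g f-poly t with f-poly t
  ... | q , q-poly , eq = q , q-poly , λ x →
    trans (+-cong (sym (f≗g x)) (-‿cong (sym (f≗g t)))) (eq x)

  polynomial-zero : ∀ n → IsPolynomial n (λ _ → 0#)
  polynomial-zero zero    = lift λ _ → refl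
  polynomial-zero (suc n) t = (λ _ → 0#) , polynomial-zero n , λ x →
    solve 2 (λ x t → :0 :- :0 := (x :- t) :* :0) refl x t

  polynomial-suc : ∀ n {f} → IsPolynomial n f → IsPolynomial (suc n) f
  polynomial-suc zero    (lift f≈0) t = (λ _ → 0#) , lift (λ _ → refl) , λ x →
    trans (+-cong (f≈0 x) (-‿cong (f≈0 t))) (solve 2 (λ x t → :0 :- :0 := (x :- t) :* :0) refl x t)
  polynomial-suc (suc n) f-poly t with f-poly t
  ... | q , q-poly , eq = q , polynomial-suc n q-poly , eq

  polynomial-const : ∀ n a → IsPolynomial (suc n) (λ _ → a)
  polynomial-const n a t = (λ _ → 0#) , polynomial-zero n , λ x →
    solve 3 (λ a x t → a :- a := (x :- t) :* :0) refl a x t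

  polynomial-+ : ∀ n {f g} → IsPolynomial n f → IsPolynomial n g → IsPolynomial n (λ x → f x + g x)
  polynomial-+ zero    (lift f≈0) (lift g≈0) = lift λ x → trans (+-cong (f≈0 x) (g≈0 x)) (+-identityˡ 0#)
  polynomial-+ (suc n) {f} {g} f-poly g-poly t with f-poly t | g-poly t
  ... | p , p-poly , p-eq | q , q-poly , q-eq =
    (λ x → p x + q x) , polynomial-+ n p-poly q-poly , λ x → begin
      (f x + g x) - (f t + g t)
        ≈⟨ solve 4 (λ a b c d → (a :+ b) :- (c :+ d) := (a :- c) :+ (b :- d)) refl (f x) (g x) (f t) (g t) ⟩
      (f x - f t) + (g x - g t)            ≈⟨ +-cong (p-eq x) (q-eq x) ⟩
      (x - t) * p x + (x - t) * q x        ≈⟨ distribˡ (x - t) (p x) (q x) ⟨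
      (x - t) * (p x + q x)                ∎

  polynomial-affine : ∀ n a b {f} → IsPolynomial n f → IsPolynomial (suc n) (λ x → (a * x + b) * f x)
  polynomial-affine zero a b {f} (lift f≈0) = polynomial-suc zero
    (lift λ x → trans (*-congˡ (f≈0 x)) (zeroʳ _))
  polynomial-affine (suc n) a b {f} f-poly t with f-poly t
  ... | q , q-poly , eq =
    -- The product rule for difference quotients.
    (λ x → (a * x + b) * q x + a * f t) ,
    polynomial-+ (suc n) (polynomial-affine n a b q-poly) (polynomial-const n (a * f t)) , λ x → begin
      (a * x + b) * f x - (a * t + b) * f t
        ≈⟨ solve 6 (λ a b x t y z →
             (a :* x :+ b) :* y :- (a :* t :+ b) :* z := (a :* x :+ b) :* (y :- z) :+ (x :- t) :* (a :* z))
             refl a b x t (f x) (f t) ⟩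
      (a * x + b) * (f x - f t) + (x - t) * (a * f t)
        ≈⟨ +-congʳ (*-congˡ (eq x)) ⟩
      (a * x + b) * ((x - t) * q x) + (x - t) * (a * f t)
        ≈⟨ solve 4 (λ l d q z → l :* (d :* q) :+ d :* z := d :* (l :* q :+ z)) refl
             (a * x + b) (x - t) (q x) (a * f t) ⟩
      (x - t) * ((a * x + b) * q x + a * f t) ∎

  polynomial-sum : ∀ n {k} {f : Fin k → Carrier → Carrier} →
    (∀ i → IsPolynomial n (f i)) → IsPolynomial n (λ x → sum λ i → f i x)
  polynomial-sum n {zero}  f-poly = polynomial-zero n
  polynomial-sum n {suc k} f-poly =
    polynomial-+ n (f-poly Fin.zero) (polynomial-sum n (f-poly ∘ Fin.suc))

  polynomial-∏ : ∀ {k} (α : Fin k → Carrier) → IsPolynomial (suc k) (λ x → ∏ λ i → x - α i)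
  polynomial-∏ {zero}  α = polynomial-const zero 1#
  polynomial-∏ {suc k} α = polynomial-cong (suc (suc k))
    (λ x → *-congʳ (+-congʳ (*-identityˡ x)))
    (polynomial-affine (suc k) 1# (- α Fin.zero) (polynomial-∏ (α ∘ Fin.suc)))

  polynomial-det : ∀ {m} (A B : Matrix m) → IsPolynomial (suc m) (λ x → det λ i j → A i j * x + B i j)
  polynomial-det {zero}  A B = polynomial-const zero 1#
  polynomial-det {suc m} A B = polynomial-sum (suc (suc m)) λ j →
    polynomial-cong (suc (suc m))
      (λ x → *-congʳ (solve 4 (λ s a x b → s :* a :* x :+ s :* b := s :* (a :* x :+ b)) refl
        (sign j) (A Fin.zero j) x (B Fin.zero j)))
      (polynomial-affine (suc m) (sign j * A Fin.zero j) (sign j * B Fin.zero j)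
        (polynomial-det (minor A j) (minor B j)))

  -- The point b + 1 is a zero, so `x - t` divides `f`. Beyond `t` this factor is apart from 0,
  -- hence the quotient vanishes there, and the degree bound has dropped. A half-line of zeros suits
  -- the application, where an identity is known only after cancelling a factor that is positive
  -- beyond some bound.
  polynomial-vanishes : ∀ n {f} → IsPolynomial n f → ∀ b → (∀ x → b < x → f x ≈ 0#) → ∀ x → f x ≈ 0#
  polynomial-vanishes zero (lift f≈0) b eventually = f≈0
  polynomial-vanishes (suc n) {f} f-poly b eventually x with f-poly (b + 1#)
  ... | q , q-poly , eq = begin
    f x                   ≈⟨ solve 2 (λ y z → y := (y :- z) :+ z) refl (f x) (f t) ⟩
    (f x - f t) + f t     ≈⟨ +-cong (eq x) ft≈0 ⟩
    (x - t) * q x + 0#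
      ≈⟨ +-congʳ (*-congˡ (polynomial-vanishes n q-poly t q-eventually x)) ⟩
    (x - t) * 0# + 0#     ≈⟨ solve 1 (λ d → d :* :0 :+ :0 := :0) refl (x - t) ⟩
    0#                    ∎
    where
    t : Carrier
    t = b + 1#

    b<t : b < t
    b<t = 0<y-x⇒x<y (<-≈-trans 0<1 (solve 1 (λ b → :1 := (b :+ :1) :- b) refl b))

    ft≈0 : f t ≈ 0#
    ft≈0 = eventually t b<t

    q-eventually : ∀ x → t < x → q x ≈ 0#
    q-eventually x t<x = cancel-*ˡ (#-sym (<⇒# (x<y⇒0<y-x t<x))) (begin
      (x - t) * q x    ≈⟨ eq x ⟨
      f x - f t        ≈⟨ +-cong (eventually x (<-trans b<t t<x)) (-‿cong ft≈0) ⟩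
      0# - 0#          ≈⟨ solve 1 (λ d → :0 :- :0 := d :* :0) refl (x - t) ⟩
      (x - t) * 0#     ∎)

-- Quadratic forms, reflections and unit eigenvectors.

module Spectra {c ℓ₁ ℓ₂ : Level} (ℝ : RealNumbers c ℓ₁ ℓ₂) where
  open RealNumbers ℝ hiding (zero)
  open LinearAlgebra ℝ
  open OrderedField ℝ
  open Determinants ℝ
  open Products ℝ
  open Polynomials ℝ
  open CommutativeRing commutativeRing using (semiring)

  open Sums semiring
    using (∑-comm; *-distribˡ-sum; *-distribʳ-sum; sum-cong-≋)
  open SetoidReasoning setoid

  dot : ∀ {m} → (Fin m → Carrier) → (Fin m → Carrier) → Carrier
  dot u v = sum λ i → u i * v i

  norm² : ∀ {m} → (Fin m → Carrier) → Carrier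
  norm² v = dot v v

  form : ∀ {m} → Matrix m → (Fin m → Carrier) → Carrier
  form X v = dot v (apply X v)

  Symmetric : ∀ {m} → Matrix m → Set ℓ₁
  Symmetric X = ∀ i j → X i j ≈ X j i

  dot-cong : ∀ {m} {u u′ v v′ : Fin m → Carrier} → u ≋ u′ → v ≋ v′ → dot u v ≈ dot u′ v′
  dot-cong u≋u′ v≋v′ = sum-cong-≋ λ i → *-cong (u≋u′ i) (v≋v′ i)

  dot-comm : ∀ {m} (u v : Fin m → Carrier) → dot u v ≈ dot v u
  dot-comm u v = sum-cong-≋ λ i → *-comm (u i) (v i)

  dot-linear : ∀ {m} a b (u v w : Fin m → Carrier) →
    dot u (λ i → a * v i + b * w i) ≈ a * dot u v + b * dot u w
  dot-linear a b u v w = trans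
    (sum-cong-≋ λ i → solve 5 (λ u a v b w → u :* (a :* v :+ b :* w) := a :* (u :* v) :+ b :* (u :* w)) refl
      (u i) a (v i) b (w i))
    (sum-linear a b (λ i → u i * v i) (λ i → u i * w i))

  norm²-nonneg : ∀ {m} (v : Fin m → Carrier) → 0# ≤ norm² v
  norm²-nonneg {zero}  v = ≈⇒≤ refl
  norm²-nonneg {suc m} v = +-nonneg (0≤x² (v Fin.zero)) (norm²-nonneg (v ∘ Fin.suc))

  norm²-pos : ∀ {m} (v : Fin m → Carrier) k → v k # 0# → ¬ ¬ (0# < norm² v)
  norm²-pos v Fin.zero    vk#0 = +-pos-nonneg (0<x² vk#0) (norm²-nonneg (v ∘ Fin.suc))
  norm²-pos v (Fin.suc k) vk#0 n = norm²-pos (v ∘ Fin.suc) k vk#0 λ 0<tail →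
    +-pos-nonneg 0<tail (0≤x² (v Fin.zero)) λ 0<sum → n (<-≈-trans 0<sum (+-comm _ _))

  norm²≈0 : ∀ {m} (v : Fin m → Carrier) → norm² v ≈ 0# → ∀ i → v i ≈ 0#
  norm²≈0 v eq i = ¬#⇒≈ λ vi#0 → norm²-pos v i vi#0 (≈⇒≤ eq)

  apply-mul : ∀ {m} (A B : Matrix m) v → apply (mul A B) v ≋ apply A (apply B v)
  apply-mul A B v i = begin
    (sum λ j → (sum λ k → A i k * B k j) * v j)
      ≈⟨ (sum-cong-≋ λ j → *-distribʳ-sum (v j) (λ k → A i k * B k j)) ⟩
    (sum λ j → sum λ k → A i k * B k j * v j)
      ≈⟨ ∑-comm (λ j k → A i k * B k j * v j) ⟩
    (sum λ k → sum λ j → A i k * B k j * v j)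
      ≈⟨ (sum-cong-≋ λ k → trans (sum-cong-≋ λ j → *-assoc (A i k) (B k j) (v j))
           (sym (*-distribˡ-sum (A i k) (λ j → B k j * v j)))) ⟩
    apply A (apply B v) i ∎

  dot-apply : ∀ {m} (H : Matrix m) → Symmetric H → ∀ u v → dot (apply H u) v ≈ dot u (apply H v)
  dot-apply H H-sym u v = begin
    (sum λ i → (sum λ j → H i j * u j) * v i)
      ≈⟨ (sum-cong-≋ λ i → *-distribʳ-sum (v i) (λ j → H i j * u j)) ⟩
    (sum λ i → sum λ j → H i j * u j * v i)
      ≈⟨ ∑-comm (λ i j → H i j * u j * v i) ⟩
    (sum λ j → sum λ i → H i j * u j * v i)
      ≈⟨ (sum-cong-≋ λ j → trans
           (sum-cong-≋ λ i → trans (*-congʳ (*-congʳ (H-sym i j)))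
             (solve 3 (λ h u v → h :* u :* v := u :* (h :* v)) refl (H j i) (u j) (v i)))
           (sym (*-distribˡ-sum (u j) (λ i → H j i * v i)))) ⟩
    dot u (apply H v) ∎

  det-one : ∀ m → det (one {m}) ≈ 1#
  det-one zero    = refl
  det-one (suc m) = trans (det-pivot (one {suc m}) Fin.zero (λ _ → refl))
    (trans (*-congˡ (det-one m)) (solve 0 (:1 :* :1 :* :1 := :1) refl))

  scalar-one : ∀ {m} x (i j : Fin m) → scalar x i j ≈ one i j * x
  scalar-one x i j with i Fin.≟ j
  ... | yes _ = sym (*-identityˡ x)
  ... | no  _ = sym (zeroˡ x)

  polynomial-charPoly : ∀ {m} (X : Matrix m) → IsPolynomial (suc m) (charPoly X)
  polynomial-charPoly {m} X = polynomial-cong (suc m)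
    (λ x → det-cong {m} {λ i j → one i j * x + neg X i j} λ i j → +-congʳ (sym (scalar-one x i j)))
    (polynomial-det one (neg X))

  -- The reflection in the hyperplane orthogonal to u, or the identity if κ and
  -- u vanish.
  module Reflection {m} (u : Fin m → Carrier) (κ : Carrier)
                    (κ²norm² : κ * (κ * norm² u) ≈ (1# + 1#) * κ) where

    H : Matrix m
    H i j = one i j - κ * (u i * u j)

    H-sym : Symmetric H
    H-sym i j = +-cong (reflexive (scalar-sym 1# i j)) (-‿cong (*-congˡ (*-comm (u i) (u j))))

    apply-H : ∀ v i → apply H v i ≈ v i - κ * u i * dot u v
    apply-H v i = begin
      (sum λ j → (one i j - κ * (u i * u j)) * v j)
        ≈⟨ (sum-cong-≋ λ j → solve 5 (λ e κ a b y →
             (e :- κ :* (a :* b)) :* y := :1 :* (e :* y) :+ (:- (κ :* a)) :* (b :* y))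
             refl (one i j) κ (u i) (u j) (v j)) ⟩
      (sum λ j → 1# * (one i j * v j) + - (κ * u i) * (u j * v j))
        ≈⟨ sum-linear 1# (- (κ * u i)) (λ j → one i j * v j) (λ j → u j * v j) ⟩
      1# * (sum λ j → one i j * v j) + - (κ * u i) * dot u v
        ≈⟨ +-congʳ (*-congˡ (sum-scalarˡ 1# i v)) ⟩
      1# * (1# * v i) + - (κ * u i) * dot u v
        ≈⟨ solve 3 (λ x a d → :1 :* (:1 :* x) :+ (:- a) :* d := x :- a :* d) refl (v i) (κ * u i) (dot u v) ⟩
      v i - κ * u i * dot u v ∎

    involutive : ∀ v → apply H (apply H v) ≋ v
    involutive v i = begin
      apply H (apply H v) i
        ≈⟨ apply-H (apply H v) i ⟩
      apply H v i - κ * u i * dot u (apply H v)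
        ≈⟨ +-cong (apply-H v i) (-‿cong (*-congˡ dot-u)) ⟩
      (v i - κ * u i * p) - κ * u i * (p - κ * p * norm² u)
        ≈⟨ solve 5 (λ x κ a p n → (x :- κ :* a :* p) :- κ :* a :* (p :- κ :* p :* n)
             := x :+ a :* p :* (κ :* (κ :* n) :- (:1 :+ :1) :* κ)) refl (v i) κ (u i) p (norm² u) ⟩
      v i + u i * p * (κ * (κ * norm² u) - (1# + 1#) * κ)
        -- The hypothesis is the usual condition κ|u|² = 2 multiplied by κ, which is all that is
        -- used here and also admits κ = 0.
        ≈⟨ +-congˡ (*-congˡ (+-congʳ κ²norm²)) ⟩
      v i + u i * p * ((1# + 1#) * κ - (1# + 1#) * κ)
        ≈⟨ solve 3 (λ x y z → x :+ y :* (z :- z) := x) refl (v i) (u i * p) ((1# + 1#) * κ) ⟩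
      v i ∎
      where
      p : Carrier
      p = dot u v

      dot-u : dot u (apply H v) ≈ p - κ * p * norm² u
      dot-u = begin
        dot u (apply H v)
          ≈⟨ dot-cong {u = u} (λ _ → refl) (λ i → trans (apply-H v i)
               (solve 4 (λ x κ a p → x :- κ :* a :* p := :1 :* x :+ (:- (κ :* p)) :* a) refl (v i) κ (u i) p)) ⟩
        dot u (λ i → 1# * v i + - (κ * p) * u i)
          ≈⟨ dot-linear 1# (- (κ * p)) u v u ⟩
        1# * p + - (κ * p) * norm² u
          ≈⟨ solve 3 (λ p a n → :1 :* p :+ (:- a) :* n := p :- a :* n) refl p (κ * p) (norm² u) ⟩
        p - κ * p * norm² u ∎

    HH : ∀ i j → mul H H i j ≈ one i j
    HH i j = begin
      apply H (λ k → H k j) i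
        ≈⟨ (sum-cong-≋ λ k → *-congˡ (sym (trans (sum-scalarʳ 1# j (H k)) (*-identityʳ _)))) ⟩
      apply H (apply H (λ k → one k j)) i    ≈⟨ involutive (λ k → one k j) i ⟩
      one i j ∎

    norm²-H : ∀ v → norm² (apply H v) ≈ norm² v
    norm²-H v = trans (dot-apply H H-sym v (apply H v)) (dot-cong {u = v} (λ _ → refl) (involutive v))

    conjugate : Matrix m → Matrix m
    conjugate X = mul H (mul X H)

    conjugate-sym : ∀ X → Symmetric X → Symmetric (conjugate X)
    conjugate-sym X X-sym i j = begin
      dot (H i) (apply X (λ l → H l j))
        ≈⟨ dot-cong {v = apply X λ l → H l j} (H-sym i) (λ k → sum-cong-≋ λ l → *-congˡ (H-sym l j)) ⟩
      dot (λ k → H k i) (apply X (H j))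
        ≈⟨ dot-apply X X-sym (λ k → H k i) (H j) ⟨
      dot (apply X (λ k → H k i)) (H j)
        ≈⟨ dot-comm (apply X λ k → H k i) (H j) ⟩
      conjugate X j i ∎

    form-conjugate : ∀ X v → form X (apply H v) ≈ form (conjugate X) v
    form-conjugate X v = begin
      dot (apply H v) (apply X (apply H v))    ≈⟨ dot-apply H H-sym v (apply X (apply H v)) ⟩
      dot v (apply H (apply X (apply H v)))
        ≈⟨ dot-cong {u = v} (λ _ → refl) (λ i → trans
             (sum-cong-≋ λ k → *-congˡ (sym (apply-mul X H v k)))
             (sym (apply-mul H (mul X H) v i))) ⟩
      form (conjugate X) v ∎

    -- Since `H` is its own inverse, xI - HXH = H(xI - X)H, and the square of `det H` is the
    -- determinant of the identity.
    charPoly-conjugate : ∀ X x → charPoly (conjugate X) x ≈ charPoly X x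
    charPoly-conjugate X x = begin
      charPoly (conjugate X) x
        ≈⟨ det-cong (λ i j → begin
             scalar x i j - conjugate X i j
               ≈⟨ +-cong (trans (scalar-one x i j) (trans (*-comm _ x) (*-congˡ (sym (HH i j)))))
                    (solve 1 (λ y → :- y := (:- :1) :* y) refl (conjugate X i j)) ⟩
             x * mul H H i j + (- 1#) * conjugate X i j
               ≈⟨ dot-linear x (- 1#) (H i) (λ k → H k j) (λ k → mul X H k j) ⟨
             dot (H i) (λ k → x * H k j + (- 1#) * mul X H k j)
               ≈⟨ dot-cong {u = H i} (λ _ → refl) (λ k → begin
                    x * H k j + (- 1#) * mul X H k j
                      ≈⟨ +-congʳ (sum-scalarˡ x k (λ l → H l j)) ⟨
                    (sum λ l → scalar x k l * H l j) + (- 1#) * mul X H k j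
                      ≈⟨ +-congʳ (*-identityˡ _) ⟨
                    1# * (sum λ l → scalar x k l * H l j) + (- 1#) * mul X H k j
                      ≈⟨ sum-linear 1# (- 1#) (λ l → scalar x k l * H l j) (λ l → X k l * H l j) ⟨
                    (sum λ l → 1# * (scalar x k l * H l j) + (- 1#) * (X k l * H l j))
                      ≈⟨ (sum-cong-≋ λ l → solve 3 (λ s y h → :1 :* (s :* h) :+ (:- :1) :* (y :* h) := (s :- y) :* h) refl
                           (scalar x k l) (X k l) (H l j)) ⟩
                    mul xI-X H k j ∎) ⟩
             conjugate xI-X i j ∎) ⟩
      det (conjugate xI-X)                  ≈⟨ det-mul H (mul xI-X H) ⟩
      det H * det (mul xI-X H)              ≈⟨ *-congˡ (det-mul xI-X H) ⟩
      det H * (det xI-X * det H)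
        ≈⟨ solve 2 (λ h d → h :* (d :* h) := d :* (h :* h)) refl (det H) (det xI-X) ⟩
      det xI-X * (det H * det H)
        ≈⟨ *-congˡ (trans (sym (det-mul H H)) (trans (det-cong HH) (det-one m))) ⟩
      det xI-X * 1#                         ≈⟨ *-identityʳ _ ⟩
      charPoly X x ∎
      where
      xI-X : Matrix m
      xI-X i j = scalar x i j - X i j

  HasUnitEigenvector : ∀ {m} → Matrix m → Carrier → Set (c ⊔ ℓ₁)
  HasUnitEigenvector X α = ∃[ v ] norm² v ≈ 1# × (∀ i → apply X v i ≈ α * v i)

  root⇒¬¬eigenvector : ∀ {m} (X : Matrix m) α → charPoly X α ≈ 0# → ¬ ¬ HasUnitEigenvector X α
  root⇒¬¬eigenvector X α root none = det≈0⇒¬¬kernel _ root λ { (v , (k , vk#0) , ker) →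
    norm²-pos v k vk#0 λ 0<N → none (normalise v ker 0<N) }
    where
    normalise : ∀ v → (∀ i → apply (λ i j → scalar α i j - X i j) v i ≈ 0#) →
      0# < norm² v → HasUnitEigenvector X α
    normalise v ker 0<N = (λ i → s⁻¹ * v i) , unit , eigen
      where
      N s s⁻¹ : Carrier
      N = norm² v
      s = √ N

      s²≈N : s * s ≈ N
      s²≈N = √-square (<⇒≤ 0<N)

      -- The square root is only known to be nonnegative, which is a negation; apartness from 0
      -- comes from its explicit inverse `s * N⁻¹`.
      s#0 : s # 0#
      s#0 = let N⁻¹ , NN⁻¹≈1 = inverse (#-sym (<⇒# 0<N))
            in unit⇒#0 (trans (sym (*-assoc s s N⁻¹)) (trans (*-congʳ s²≈N) NN⁻¹≈1))

      s⁻¹ = proj₁ (inverse s#0)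

      unit : norm² (λ i → s⁻¹ * v i) ≈ 1#
      unit = begin
        norm² (λ i → s⁻¹ * v i)
          ≈⟨ (sum-cong-≋ λ i → solve 2 (λ s v → (s :* v) :* (s :* v) := (s :* s) :* (v :* v)) refl s⁻¹ (v i)) ⟩
        (sum λ i → (s⁻¹ * s⁻¹) * (v i * v i))    ≈⟨ *-distribˡ-sum (s⁻¹ * s⁻¹) (λ i → v i * v i) ⟨
        (s⁻¹ * s⁻¹) * N                          ≈⟨ *-congˡ s²≈N ⟨
        (s⁻¹ * s⁻¹) * (s * s)
          ≈⟨ solve 2 (λ s t → (t :* t) :* (s :* s) := (s :* t) :* (s :* t)) refl s s⁻¹ ⟩
        (s * s⁻¹) * (s * s⁻¹)                    ≈⟨ *-cong (proj₂ (inverse s#0)) (proj₂ (inverse s#0)) ⟩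
        1# * 1#                                  ≈⟨ *-identityˡ 1# ⟩
        1#                                       ∎

      eigen-v : ∀ i → apply X v i ≈ α * v i
      eigen-v i = begin
        apply X v i
          ≈⟨ solve 2 (λ a b → a := b :+ (:- (:1 :* b :+ (:- :1) :* a))) refl (apply X v i) (α * v i) ⟩
        α * v i + - (1# * (α * v i) + (- 1#) * apply X v i)
          ≈⟨ +-congˡ (-‿cong (begin
               1# * (α * v i) + (- 1#) * apply X v i
                 ≈⟨ +-congʳ (*-congˡ (sum-scalarˡ α i v)) ⟨
               1# * (sum λ j → scalar α i j * v j) + (- 1#) * apply X v i
                 ≈⟨ sum-linear 1# (- 1#) (λ j → scalar α i j * v j) (λ j → X i j * v j) ⟨
               (sum λ j → 1# * (scalar α i j * v j) + (- 1#) * (X i j * v j))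
                 ≈⟨ (sum-cong-≋ λ j → solve 3 (λ s x v → :1 :* (s :* v) :+ (:- :1) :* (x :* v) := (s :- x) :* v) refl
                      (scalar α i j) (X i j) (v j)) ⟩
               apply (λ i j → scalar α i j - X i j) v i
                 ≈⟨ ker i ⟩
               0# ∎)) ⟩
        α * v i + - 0#    ≈⟨ solve 1 (λ a → a :+ (:- :0) := a) refl (α * v i) ⟩
        α * v i           ∎

      eigen : ∀ i → apply X (λ i → s⁻¹ * v i) i ≈ α * (s⁻¹ * v i)
      eigen i = begin
        apply X (λ i → s⁻¹ * v i) i
          ≈⟨ (sum-cong-≋ λ j → solve 3 (λ x s v → x :* (s :* v) := s :* (x :* v)) refl (X i j) s⁻¹ (v j)) ⟩
        (sum λ j → s⁻¹ * (X i j * v j))    ≈⟨ *-distribˡ-sum s⁻¹ (λ j → X i j * v j) ⟨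
        s⁻¹ * apply X v i                  ≈⟨ *-congˡ (eigen-v i) ⟩
        s⁻¹ * (α * v i)                    ≈⟨ solve 3 (λ s a v → s :* (a :* v) := a :* (s :* v)) refl s⁻¹ α (v i) ⟩
        α * (s⁻¹ * v i)                    ∎

-- Orthogonal diagonalisation and monotonicity of eigenvalues.

module Weyl {c ℓ₁ ℓ₂ : Level} (ℝ : RealNumbers c ℓ₁ ℓ₂) where
  open RealNumbers ℝ hiding (zero)
  open LinearAlgebra ℝ
  open OrderedField ℝ
  open Determinants ℝ
  open Products ℝ
  open Polynomials ℝ
  open Spectra ℝ
  open CommutativeRing commutativeRing using (semiring)
  open HeytingProperties heytingCommutativeRing using (#-congʳ)
  open Sums semiring
    using (∑-distrib-+; *-distribˡ-sum; sum-cong-≋)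
  open SetoidReasoning setoid

  -- An orthogonal change of coordinates is recorded by its effect on norms and on the quadratic
  -- form alone, which is what the comparison of eigenvalues consumes.
  Diagonalises : ∀ {m} → Matrix m → (Fin m → Carrier) → Matrix m → Set (c ⊔ ℓ₁)
  Diagonalises X α C = (∀ v → norm² (apply C v) ≈ norm² v) ×
                       (∀ v → form X (apply C v) ≈ sum λ i → α i * (v i * v i))

  -- The reflection exchanging a unit vector v and the first basis vector.
  module _ {m} (v : Fin (suc m) → Carrier) (unit : norm² v ≈ 1#) where
    private
      u : Fin (suc m) → Carrier
      u i = v i - one Fin.zero i

      -- Half of the squared norm of `u`, so its reciprocal is the coefficient κ of the reflection
      -- along `u`.
      w : Carrier
      w = 1# - v Fin.zero

      norm²-u : norm² u ≈ (1# + 1#) * w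
      norm²-u = begin
        norm² u
          ≈⟨ (sum-cong-≋ λ i → solve 2 (λ v e → (v :- e) :* (v :- e) :=
               :1 :* (v :* v) :+ :1 :* (e :* (e :- (:1 :+ :1) :* v))) refl (v i) (one Fin.zero i)) ⟩
        (sum λ i → 1# * (v i * v i) + 1# * (one Fin.zero i * (one Fin.zero i - (1# + 1#) * v i)))
          ≈⟨ sum-linear 1# 1# (λ i → v i * v i) (λ i → one Fin.zero i * (one Fin.zero i - (1# + 1#) * v i)) ⟩
        1# * norm² v + 1# * (sum λ i → one Fin.zero i * (one Fin.zero i - (1# + 1#) * v i))
          ≈⟨ +-cong (*-congˡ unit) (*-congˡ (sum-scalarˡ 1# Fin.zero (λ i → one Fin.zero i - (1# + 1#) * v i))) ⟩
        1# * 1# + 1# * (1# * (1# - (1# + 1#) * v Fin.zero))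
          ≈⟨ solve 1 (λ x → :1 :* :1 :+ :1 :* (:1 :* (:1 :- (:1 :+ :1) :* x)) := (:1 :+ :1) :* (:1 :- x))
               refl (v Fin.zero) ⟩
        (1# + 1#) * w ∎

    -- If `w` is apart from 0, κ is its inverse. If `w` vanishes, then so does `u`: the vector `v`
    -- already is the first basis vector, and κ = 0 turns the reflection into the identity. The last
    -- equation is the common consequence from which H e_0 = v follows.
    ¬¬reflection : ¬ ¬ (∃[ κ ] κ * (κ * norm² u) ≈ (1# + 1#) * κ × (∀ i → κ * w * u i ≈ u i))
    ¬¬reflection none = ¬¬#⊎≈ w 0#
      [ (λ w#0 → let κ , wκ≈1 = inverse w#0 in none
          ( κ
          , (begin
              κ * (κ * norm² u)            ≈⟨ *-congˡ (*-congˡ norm²-u) ⟩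
              κ * (κ * ((1# + 1#) * w))
                ≈⟨ solve 2 (λ κ w → κ :* (κ :* ((:1 :+ :1) :* w)) := (:1 :+ :1) :* κ :* (w :* κ)) refl κ w ⟩
              (1# + 1#) * κ * (w * κ)      ≈⟨ *-congˡ wκ≈1 ⟩
              (1# + 1#) * κ * 1#           ≈⟨ *-identityʳ _ ⟩
              (1# + 1#) * κ                ∎)
          , λ i → trans (*-congʳ (trans (*-comm κ w) wκ≈1)) (*-identityˡ (u i)) ))
      , (λ w≈0 → none
          ( 0#
          , solve 1 (λ n → :0 :* (:0 :* n) := (:1 :+ :1) :* :0) refl (norm² u)
          , λ i → trans (trans (*-congʳ (zeroˡ w)) (zeroˡ (u i)))
              (sym (norm²≈0 u (trans norm²-u (trans (*-congˡ w≈0) (zeroʳ _))) i)) )) ]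

    module _ (κ : Carrier) (κ²norm² : κ * (κ * norm² u) ≈ (1# + 1#) * κ) (κw : ∀ i → κ * w * u i ≈ u i) where
      open Reflection u κ κ²norm²

      H-zero : ∀ i → H i Fin.zero ≈ v i
      H-zero i = begin
        one i Fin.zero - κ * (u i * u Fin.zero)
          ≈⟨ +-congʳ (reflexive (scalar-sym 1# i Fin.zero)) ⟩
        one Fin.zero i - κ * (u i * (v Fin.zero - 1#))
          ≈⟨ solve 4 (λ e κ u x → e :- κ :* (u :* (x :- :1)) := e :+ κ :* (:1 :- x) :* u) refl
               (one Fin.zero i) κ (u i) (v Fin.zero) ⟩
        one Fin.zero i + κ * w * u i
          ≈⟨ +-congˡ (κw i) ⟩
        one Fin.zero i + (v i - one Fin.zero i)
          ≈⟨ solve 2 (λ e x → e :+ (x :- e) := x) refl (one Fin.zero i) (v i) ⟩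
        v i ∎

      -- H takes e_0 to v, X multiplies v by α, and H takes v back to e_0.
      conjugate-zero : ∀ X α → (∀ i → apply X v i ≈ α * v i) → ∀ i → conjugate X i Fin.zero ≈ α * one i Fin.zero
      conjugate-zero X α eigen i = begin
        (sum λ k → H i k * sum λ l → X k l * H l Fin.zero)
          ≈⟨ (sum-cong-≋ λ k → *-congˡ {H i k} (trans (sum-cong-≋ λ l → *-congˡ {X k l} (H-zero l))
               (eigen k))) ⟩
        (sum λ k → H i k * (α * v k))
          ≈⟨ (sum-cong-≋ λ k → trans (solve 3 (λ h a v → h :* (a :* v) := a :* (h :* v)) refl (H i k) α (v k))
               (*-congˡ {α} (*-congˡ {H i k} (sym (H-zero k))))) ⟩
        (sum λ k → α * (H i k * H k Fin.zero))
          ≈⟨ *-distribˡ-sum α (λ k → H i k * H k Fin.zero) ⟨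
        α * (sum λ k → H i k * H k Fin.zero)
          ≈⟨ *-congˡ (HH i Fin.zero) ⟩
        α * one i Fin.zero ∎

  charPoly-deflate : ∀ {m} (X : Matrix (suc m)) → (∀ i → X Fin.zero (Fin.suc i) ≈ 0#) → ∀ x →
    charPoly X x ≈ (x - X Fin.zero Fin.zero) * charPoly (λ i j → X (Fin.suc i) (Fin.suc j)) x
  charPoly-deflate X zeros x = trans
    (det-pivot (λ i j → scalar x i j - X i j) Fin.zero
      (λ i → trans (+-congˡ (-‿cong (zeros i))) (solve 0 (:0 :- :0 := :0) refl)))
    (*-congʳ (*-identityˡ _))

  form-deflate : ∀ {m} (X : Matrix (suc m)) → (∀ i → X Fin.zero (Fin.suc i) ≈ 0#) →
    (∀ i → X (Fin.suc i) Fin.zero ≈ 0#) → ∀ v →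
    form X v ≈ X Fin.zero Fin.zero * (v Fin.zero * v Fin.zero) + form (λ i j → X (Fin.suc i) (Fin.suc j)) (tail v)
  form-deflate X row column v = +-cong
    (trans (*-congˡ (+-congˡ (sum-zero λ i → trans (*-congʳ (row i)) (zeroˡ _))))
      (solve 2 (λ v x → v :* (x :* v :+ :0) := x :* (v :* v)) refl (v Fin.zero) (X Fin.zero Fin.zero)))
    (sum-cong-≋ λ i → *-congˡ (trans (+-congʳ (trans (*-congʳ (column i)) (zeroˡ _))) (+-identityˡ _)))

  -- Deflation: conjugation by the reflection of a unit eigenvector for `α zero` clears the first
  -- column outside the corner, symmetry clears the first row with it, and the remaining block `Z`
  -- is symmetric again. As the roots are consumed in the order of `α`, the diagonal form lists them
  -- in that order.
  symmetric⇒¬¬diagonalisable : ∀ {m} (X : Matrix m) → Symmetric X → ∀ α →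
    (∀ x → charPoly X x ≈ ∏ λ i → x - α i) → ¬ ¬ (∃[ C ] Diagonalises X α C)
  symmetric⇒¬¬diagonalisable {zero} X X-sym α splits none =
    none (X , (λ _ → refl) , (λ _ → refl))
  symmetric⇒¬¬diagonalisable {suc m} X X-sym α splits none =
    root⇒¬¬eigenvector X (α Fin.zero) root λ { (v , unit , eigen) →
    ¬¬reflection v unit λ { (κ , κ²norm² , κw) → deflate v unit eigen κ κ²norm² κw } }
    where
    root : charPoly X (α Fin.zero) ≈ 0#
    root = trans (splits (α Fin.zero)) (trans (*-congʳ (-‿inverseʳ (α Fin.zero)))
      (zeroˡ (∏ λ i → α Fin.zero - α (Fin.suc i))))

    deflate : ∀ v (unit : norm² v ≈ 1#) → (∀ i → apply X v i ≈ α Fin.zero * v i) →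
      ∀ κ (κ²norm² : κ * (κ * _) ≈ (1# + 1#) * κ) (κw : ∀ i → κ * _ * _ ≈ _) → ⊥
    deflate v unit eigen κ κ²norm² κw =
      symmetric⇒¬¬diagonalisable Z (λ i j → Y-sym (Fin.suc i) (Fin.suc j)) (tail α) splits-Z
        λ { (C , C-norm² , C-form) → none (mul H (extend C) , norm²-preserved C C-norm² , diagonal C C-form) }
      where
      open module R = Reflection (λ i → v i - one Fin.zero i) κ κ²norm² using (H)

      Y : Matrix (suc m)
      Y = R.conjugate X

      Y-sym : Symmetric Y
      Y-sym = R.conjugate-sym X X-sym

      Y-zero : ∀ i → Y i Fin.zero ≈ α Fin.zero * one i Fin.zero
      Y-zero = conjugate-zero v unit κ κ²norm² κw X (α Fin.zero) eigen

      Y-corner : Y Fin.zero Fin.zero ≈ α Fin.zero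
      Y-corner = trans (Y-zero Fin.zero) (*-identityʳ (α Fin.zero))

      Y-column : ∀ i → Y (Fin.suc i) Fin.zero ≈ 0#
      Y-column i = trans (Y-zero (Fin.suc i)) (zeroʳ (α Fin.zero))

      Y-row : ∀ i → Y Fin.zero (Fin.suc i) ≈ 0#
      Y-row i = trans (Y-sym Fin.zero (Fin.suc i)) (Y-column i)

      Z : Matrix m
      Z i j = Y (Fin.suc i) (Fin.suc j)

      ∏Z : Carrier → Carrier
      ∏Z x = ∏ λ i → x - α (Fin.suc i)

      -- What is known is the identity multiplied by `x - α zero`. The factor can be cancelled for
      -- `α zero < x`, and two polynomial functions that agree there agree everywhere.
      splits-Z : ∀ x → charPoly Z x ≈ ∏Z x
      splits-Z x = begin
        charPoly Z x                       ≈⟨ solve 2 (λ a b → a := (a :+ (:- :1) :* b) :+ b) refl (charPoly Z x) (∏Z x) ⟩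
        (charPoly Z x + (- 1#) * ∏Z x) + ∏Z x
          ≈⟨ +-congʳ (polynomial-vanishes (suc (suc m)) difference-polynomial (α Fin.zero) eventually x) ⟩
        0# + ∏Z x                          ≈⟨ +-identityˡ _ ⟩
        ∏Z x                               ∎
        where
        difference-polynomial : IsPolynomial (suc (suc m)) (λ x → charPoly Z x + (- 1#) * ∏Z x)
        -- The factor -1 is treated as an affine factor of slope 0, which raises the degree bound by
        -- one; the bound of the other summand is raised to match.
        difference-polynomial = polynomial-+ (suc (suc m))
          (polynomial-suc (suc m) (polynomial-charPoly Z))
          (polynomial-cong (suc (suc m)) (λ x → *-congʳ (solve 1 (λ x → :0 :* x :+ (:- :1) := :- :1) refl x))
            (polynomial-affine (suc m) 0# (- 1#) (polynomial-∏ (tail α))))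

        eventually : ∀ x → α Fin.zero < x → charPoly Z x + (- 1#) * ∏Z x ≈ 0#
        eventually x α₀<x = trans (+-congʳ (cancel-*ˡ (#-sym (<⇒# (x<y⇒0<y-x α₀<x))) (begin
          (x - α Fin.zero) * charPoly Z x            ≈⟨ *-congʳ (+-congˡ (-‿cong Y-corner)) ⟨
          (x - Y Fin.zero Fin.zero) * charPoly Z x   ≈⟨ charPoly-deflate Y Y-row x ⟨
          charPoly Y x                               ≈⟨ R.charPoly-conjugate X x ⟩
          charPoly X x                               ≈⟨ splits x ⟩
          (x - α Fin.zero) * ∏Z x                    ∎)))
          (solve 1 (λ a → a :+ (:- :1) :* a := :0) refl (∏Z x))

      extend : Matrix m → Matrix (suc m)
      extend C = one Fin.zero ∷ λ i → 0# ∷ C i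

      extend-zero : ∀ C u → apply (extend C) u Fin.zero ≈ u Fin.zero
      extend-zero C u = trans (sum-scalarˡ 1# Fin.zero u) (*-identityˡ _)

      extend-suc : ∀ C u i → apply (extend C) u (Fin.suc i) ≈ apply C (tail u) i
      extend-suc C u i = trans (+-congʳ (zeroˡ _)) (+-identityˡ _)

      norm²-preserved : ∀ C → (∀ u → norm² (apply C u) ≈ norm² u) →
        ∀ u → norm² (apply (mul H (extend C)) u) ≈ norm² u
      norm²-preserved C C-norm² u = begin
        norm² (apply (mul H (extend C)) u)
          ≈⟨ dot-cong (apply-mul H (extend C) u) (apply-mul H (extend C) u) ⟩
        norm² (apply H (apply (extend C) u))
          ≈⟨ R.norm²-H (apply (extend C) u) ⟩
        norm² (apply (extend C) u)
          ≈⟨ +-cong (*-cong (extend-zero C u) (extend-zero C u)) (trans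
               (dot-cong (extend-suc C u) (extend-suc C u)) (C-norm² (tail u))) ⟩
        norm² u ∎

      form-cong : ∀ {k} (X : Matrix k) {u v} → u ≋ v → form X u ≈ form X v
      form-cong X u≋v = dot-cong u≋v (λ i → dot-cong {u = X i} (λ _ → refl) u≋v)

      diagonal : ∀ C → (∀ u → form Z (apply C u) ≈ sum λ i → α (Fin.suc i) * (u i * u i)) →
        ∀ u → form X (apply (mul H (extend C)) u) ≈ sum λ i → α i * (u i * u i)
      diagonal C C-form u = begin
        form X (apply (mul H (extend C)) u)
          ≈⟨ form-cong X (apply-mul H (extend C) u) ⟩
        form X (apply H (apply (extend C) u))
          ≈⟨ R.form-conjugate X (apply (extend C) u) ⟩
        form Y (apply (extend C) u)
          ≈⟨ form-deflate Y Y-row Y-column (apply (extend C) u) ⟩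
        Y Fin.zero Fin.zero * (apply (extend C) u Fin.zero * apply (extend C) u Fin.zero) +
          form Z (tail (apply (extend C) u))
          ≈⟨ +-cong (*-cong Y-corner (*-cong (extend-zero C u) (extend-zero C u)))
                    (trans (form-cong Z (extend-suc C u)) (C-form (tail u))) ⟩
        (sum λ i → α i * (u i * u i)) ∎

  -- Courant–Fischer: the span of the first j + 1 eigenvectors of A meets the
  -- span of the eigenvectors of B from the j-th on, for dimension reasons.
  eigenvalue-mono : ∀ {m} {A B : Matrix m} {α β} → Symmetric A → Symmetric B →
    IsSpectrum A α → IsSpectrum B β → ∀ t →
    (∀ v → form A v + t * norm² v ≤ form B v) → ∀ j → α j + t ≤ β j
  eigenvalue-mono {m} {A} {B} {α} {β} A-sym B-sym A-spec B-spec t A≤B j β<α+t =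
    symmetric⇒¬¬diagonalisable A A-sym α (IsSpectrum.splits A-spec) λ { (C , C-norm² , C-form) →
    symmetric⇒¬¬diagonalisable B B-sym β (IsSpectrum.splits B-spec) λ { (D , D-norm² , D-form) →
    wide⇒¬¬kernel (system C D) λ { (e , (k , ek#0) , ker) →
    contradict C C-norm² C-form D D-norm² D-form e k ek#0 ker } } }
    where
    select : ∀ {a} {A : Set a} → Fin m → A → A → A
    select l x y with l Fin.<? j
    ... | yes _ = x
    ... | no  _ = y

    -- Column j of `C` comes first, then at place l + 1 column l of `C` if l < j and minus column l
    -- of `D` if l ≥ j. These are (j + 1) + (m - j) = m + 1 columns of length m, and a kernel vector
    -- expresses a common vector of the two spans.
    system : Matrix m → Matrix m → Fin m → Fin (suc m) → Carrier
    system C D i Fin.zero    = C i j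
    system C D i (Fin.suc l) = select l (C i l) (- D i l)

    contradict : ∀ C → (∀ v → norm² (apply C v) ≈ norm² v) →
      (∀ v → form A (apply C v) ≈ sum λ i → α i * (v i * v i)) →
      ∀ D → (∀ v → norm² (apply D v) ≈ norm² v) →
      (∀ v → form B (apply D v) ≈ sum λ i → β i * (v i * v i)) →
      ∀ e k → e k # 0# → (∀ i → apply (system C D) e i ≈ 0#) → ⊥
    contradict C C-norm² C-form D D-norm² D-form e k ek#0 ker = 0<N k ek#0 λ 0<N →
      -- As `N` is positive, the chain `(α j + t) * N ≤ form A y + t * N ≤ form B y ≤ β j *
      -- N` is incompatible with `β j < α j + t`.
      ≤-trans (≤-respˡ (sym (distribʳ N (α j) t)) (≤-trans
        (+-mono-≤ form-A (≈⇒≤ refl)) (A≤B y))) form-B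
        (0<y-x⇒x<y (<-≈-trans (*-pos (x<y⇒0<y-x β<α+t) 0<N)
          (solve 3 (λ a b n → (a :- b) :* n := a :* n :- b :* n) refl (α j + t) (β j) N)))
      where
      -- The coordinates of the common vector `y` with respect to the columns of `C` and of `D`: `p`
      -- is supported on l ≤ j and `d` on l ≥ j.
      p d : Fin m → Carrier
      p l = one j l * e Fin.zero + select l (e (Fin.suc l)) 0#
      d l = select l 0# (e (Fin.suc l))

      y : Fin m → Carrier
      y = apply C p

      N : Carrier
      N = norm² y

      Cp≋Dd : y ≋ apply D d
      Cp≋Dd i = begin
        (sum λ l → C i l * (one j l * e Fin.zero + select l (e (Fin.suc l)) 0#))
          ≈⟨ (sum-cong-≋ λ l → trans
               (solve 4 (λ x o z y → x :* (o :* z :+ y) := :1 :* (o :* (x :* z)) :+ :1 :* (x :* y)) refl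
                 (C i l) (one j l) (e Fin.zero) (select l (e (Fin.suc l)) 0#))
               (+-congˡ (*-congˡ (swap-sides l)))) ⟩
        (sum λ l → 1# * (one j l * (C i l * e Fin.zero)) +
                   1# * (1# * (system C D i (Fin.suc l) * e (Fin.suc l)) + 1# * (D i l * d l)))
          ≈⟨ sum-linear 1# 1# (λ l → one j l * (C i l * e Fin.zero))
               (λ l → 1# * (system C D i (Fin.suc l) * e (Fin.suc l)) + 1# * (D i l * d l)) ⟩
        1# * (sum λ l → one j l * (C i l * e Fin.zero)) +
          1# * (sum λ l → 1# * (system C D i (Fin.suc l) * e (Fin.suc l)) + 1# * (D i l * d l))
          ≈⟨ +-cong (*-congˡ (sum-scalarˡ 1# j (λ l → C i l * e Fin.zero)))
                    (*-congˡ (sum-linear 1# 1# (λ l → system C D i (Fin.suc l) * e (Fin.suc l)) (λ l → D i l * d l))) ⟩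
        1# * (1# * (C i j * e Fin.zero)) + 1# * (1# * S + 1# * apply D d i)
          ≈⟨ solve 3 (λ x s z → :1 :* (:1 :* x) :+ :1 :* (:1 :* s :+ :1 :* z) := (x :+ s) :+ z) refl
               (C i j * e Fin.zero) S (apply D d i) ⟩
        apply (system C D) e i + apply D d i
          ≈⟨ +-congʳ (ker i) ⟩
        0# + apply D d i
          ≈⟨ +-identityˡ _ ⟩
        apply D d i ∎
        where
        S : Carrier
        S = sum λ l → system C D i (Fin.suc l) * e (Fin.suc l)

        swap-sides : ∀ l → C i l * select l (e (Fin.suc l)) 0# ≈
          1# * (system C D i (Fin.suc l) * e (Fin.suc l)) + 1# * (D i l * d l)
        swap-sides l with l Fin.<? j
        ... | yes _ = solve 3 (λ x y z → x :* y := :1 :* (x :* y) :+ :1 :* (z :* :0)) refl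
                        (C i l) (e (Fin.suc l)) (D i l)
        ... | no  _ = solve 3 (λ x y z → x :* :0 := :1 :* ((:- z) :* y) :+ :1 :* (z :* y)) refl
                        (C i l) (e (Fin.suc l)) (D i l)

      N≈p : N ≈ norm² p
      N≈p = C-norm² p

      N≈d : N ≈ norm² d
      N≈d = trans (dot-cong Cp≋Dd Cp≋Dd) (D-norm² d)

      -- Each coordinate of `e` occurs as a coordinate of `p` or of `d`, and the norm of `y` can be
      -- read off from either of them.
      0<N : ∀ k → e k # 0# → ¬ ¬ (0# < N)
      0<N Fin.zero e₀#0 n = norm²-pos p j pj#0 λ 0<p → n (<-≈-trans 0<p (sym N≈p))
        where
        pj#0 : p j # 0#
        pj#0 with j Fin.<? j
        ... | yes j<j = ⊥-elim (ℕₚ.<-irrefl ≡.refl j<j)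
        ... | no _ = #-congʳ (sym (trans (+-identityʳ _)
          (trans (*-congʳ (reflexive (scalar-≡ 1# j))) (*-identityˡ _)))) e₀#0
      0<N (Fin.suc l) eₗ#0 n = [ in-p , in-d ] nonzero
        where
        nonzero : p l # 0# ⊎ d l # 0#
        nonzero with l Fin.<? j
        ... | yes l<j = inj₁ (#-congʳ (sym (trans (+-congʳ (trans
          (*-congʳ (reflexive (scalar-≢ 1# λ j≡l → ℕₚ.<-irrefl (≡.cong toℕ (≡.sym j≡l)) l<j)))
          (zeroˡ _))) (+-identityˡ _))) eₗ#0)
        ... | no _ = inj₂ eₗ#0

        in-p : p l # 0# → ⊥
        in-p pl#0 = norm²-pos p l pl#0 λ 0<p → n (<-≈-trans 0<p (sym N≈p))

        in-d : d l # 0# → ⊥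
        in-d dl#0 = norm²-pos d l dl#0 λ 0<d → n (<-≈-trans 0<d (sym N≈d))

      form-A : α j * N ≤ form A y
      form-A = ≤-respˡ (sym (trans (*-congˡ N≈p) (*-distribˡ-sum (α j) (λ l → p l * p l))))
        (≤-respʳ (sym (C-form p)) (sum-mono below))
        where
        below : ∀ l → α j * (p l * p l) ≤ α l * (p l * p l)
        below l with l Fin.≤? j
        ... | yes l≤j = *-monoʳ-≤ (0≤x² (p l)) (IsSpectrum.decreasing A-spec l≤j)
        ... | no l≰j = ≈⇒≤ (trans (vanish (α j)) (sym (vanish (α l))))
          where
          pl≈0 : p l ≈ 0#
          pl≈0 with l Fin.<? j
          ... | yes l<j = ⊥-elim (l≰j (ℕₚ.<⇒≤ l<j))
          ... | no _ = trans (+-identityʳ _) (trans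
            (*-congʳ (reflexive (scalar-≢ 1# λ j≡l → l≰j (ℕₚ.≤-reflexive (≡.cong toℕ (≡.sym j≡l)))))) (zeroˡ _))

          vanish : ∀ x → x * (p l * p l) ≈ 0#
          vanish x = trans (*-congˡ (trans (*-congʳ pl≈0) (zeroˡ (p l)))) (zeroʳ x)

      form-B : form B y ≤ β j * N
      form-B = ≤-respʳ (sym (trans (*-congˡ N≈d) (*-distribˡ-sum (β j) (λ l → d l * d l))))
        (≤-respˡ (sym (trans (dot-cong Cp≋Dd (λ i → dot-cong {u = B i} (λ _ → refl) Cp≋Dd)) (D-form d)))
          (sum-mono above))
        where
        above : ∀ l → β l * (d l * d l) ≤ β j * (d l * d l)
        above l with l Fin.<? j
        ... | yes _ = ≈⇒≤ (solve 2 (λ x y → x :* (:0 :* :0) := y :* (:0 :* :0)) refl (β l) (β j))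
        ... | no l≮j = *-monoʳ-≤ (0≤x² (e (Fin.suc l))) (IsSpectrum.decreasing B-spec (ℕₚ.≮⇒≥ l≮j))

  -- As double sums, the two sides agree term by term off the diagonal, and on it they differ by
  -- nonnegative multiples of the squares `v i * v i`.
  form-mono : ∀ {m} (A B : Matrix m) t → (∀ i → A i i + t ≤ B i i) →
    (∀ i j → i ≢ j → A i j ≈ B i j) → ∀ v → form A v + t * norm² v ≤ form B v
  form-mono {m} A B t diagonal off-diagonal v = ≤-respˡ expand (sum-mono λ i →
    ≤-respˡ (sym (*-distribˡ-sum (v i) (λ j → (A i j + scalar t i j) * v j)))
      (≤-respʳ (sym (*-distribˡ-sum (v i) (λ j → B i j * v j))) (sum-mono (entry i))))
    where
    expand : (sum λ i → v i * sum λ j → (A i j + scalar t i j) * v j) ≈ form A v + t * norm² v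
    expand = begin
      (sum λ i → v i * sum λ j → (A i j + scalar t i j) * v j)
        ≈⟨ (sum-cong-≋ λ i → *-congˡ {v i} (begin
             (sum λ j → (A i j + scalar t i j) * v j)
               ≈⟨ (sum-cong-≋ λ j → distribʳ (v j) (A i j) (scalar t i j)) ⟩
             (sum λ j → A i j * v j + scalar t i j * v j)
               ≈⟨ ∑-distrib-+ (λ j → A i j * v j) (λ j → scalar t i j * v j) ⟩
             apply A v i + (sum λ j → scalar t i j * v j)
               ≈⟨ +-cong (sym (*-identityˡ _)) (sum-scalarˡ t i v) ⟩
             1# * apply A v i + t * v i ∎)) ⟩
      (sum λ i → v i * (1# * apply A v i + t * v i))    ≈⟨ dot-linear 1# t v (apply A v) v ⟩
      1# * form A v + t * norm² v                       ≈⟨ +-congʳ (*-identityˡ _) ⟩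
      form A v + t * norm² v                            ∎

    entry : ∀ i j → v i * ((A i j + scalar t i j) * v j) ≤ v i * (B i j * v j)
    entry i j with i Fin.≟ j
    ... | yes ≡.refl = ≤-respˡ (rearrange (A i i + t))
      (≤-respʳ (rearrange (B i i)) (*-monoʳ-≤ (0≤x² (v i)) (diagonal i)))
      where
      rearrange : ∀ x → x * (v i * v i) ≈ v i * (x * v i)
      rearrange x = solve 2 (λ x y → x :* (y :* y) := y :* (x :* y)) refl x (v i)
    ... | no i≢j = ≈⇒≤ (*-congˡ (*-congʳ (trans (+-identityʳ _) (off-diagonal i j i≢j))))

-- Counting, and prime factors of the subset products.

count-mono : ∀ {n p q} {P : Fin n → Set p} {Q : Fin n → Set q} (P? : Decidable P) (Q? : Decidable Q) →
  P ⊆ Q → count P? ℕ.≤ count Q?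
count-mono {n} P? Q? P⊆Q = Sublistₚ.length-mono-≤
  (Sublistₚ.filter⁺ P? Q? (λ { ≡.refl → P⊆Q }) (Sublist.⊆-refl {x = allFin n}))

count≤n : ∀ {n p} {P : Fin n → Set p} (P? : Decidable P) → count P? ℕ.≤ n
count≤n {n} P? = ℕₚ.≤-trans (Listₚ.length-filter P? (allFin n))
  (ℕₚ.≤-reflexive (Listₚ.length-tabulate {n = n} id))

-- The family `B` is arbitrary because the left fold continues with `B ∘ suc` after each entry.
foldl-invariant : ∀ {a b p q} {A : Set a} {Q : A → Set q} (B : ℕ → Set b)
  (_⊕_ : ∀ {n} → B n → A → B (suc n))
  (P : ∀ {n} → B n → Set p) → (∀ {n} {e : B n} {x} → P e → Q x → P (e ⊕ x)) →
  ∀ {n} {e : B 0} {xs : Vec A n} → P e → VecAll.All Q xs → P (Vec.foldl B _⊕_ e xs)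
foldl-invariant B _⊕_ P step Pe VecAll.[] = Pe
foldl-invariant B _⊕_ P step Pe (Qx VecAll.∷ Qxs) = foldl-invariant (B ∘ suc) _⊕_ P step (step Pe Qx) Qxs

-- The first of the products is the empty one.
subsetProducts-divisible : ∀ {q r} {Q : ℕ → Set q} {ps : Vec ℕ r} → VecAll.All Q ps →
  ∀ i → toℕ i ≢ 0 → ∃[ p ] Q p × p ∣ Vec.lookup (subsetProducts ps) i
subsetProducts-divisible {Q = Q} = foldl-invariant (λ r → Vec ℕ (2 ℕ.^ r)) _ Divisible (λ {_} {ds} → step {ds = ds})
  (λ { Fin.zero 0≢0 → ⊥-elim (0≢0 ≡.refl) })
  where
  Divisible : ∀ {k} → Vec ℕ k → Set _
  Divisible {k} ds = ∀ (i : Fin k) → toℕ i ≢ 0 → ∃[ p ] Q p × p ∣ Vec.lookup ds i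

  step : ∀ {k} {ds : Vec ℕ k} {p} → Divisible ds → Q p →
    Divisible (ds Vec.++ (Vec.map (ℕ._* p) ds Vec.++ Vec.[]))
  step {k} {ds} {p} ih Qp i i≢0 with Fin.splitAt k i in eq
  ... | inj₁ j = let p′ , Qp′ , p′∣ = ih j (i≢0 ∘ ≡.trans toℕ-i) in
    p′ , Qp′ , ≡.subst (p′ ∣_)
      (≡.sym (≡.trans (Vecₚ.lookup-splitAt k ds _ i) (≡.cong [ Vec.lookup ds , _ ] eq))) p′∣
    where
    toℕ-i : toℕ i ≡ toℕ j
    toℕ-i = ≡.trans (≡.cong toℕ (≡.sym (Finₚ.splitAt⁻¹-↑ˡ eq))) (Finₚ.toℕ-↑ˡ j _)
  -- Every entry of the second half carries the new factor `p`, its first entry included.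
  ... | inj₂ j = p , Qp ,
    ≡.subst (p ∣_) (≡.sym (≡.trans (Vecₚ.lookup-splitAt k ds _ i) (≡.cong [ Vec.lookup ds , _ ] eq)))
      (VecAllₚ.lookup⁺ {P = p ∣_}
        (VecAllₚ.++⁺ (VecAllₚ.map⁺ (VecAll.universal (λ x → n∣m*n x {p}) ds)) VecAll.[]) j)

-- Units modulo n and degrees in the generating graph.

module _ (n : ℕ) .{{_ : NonZero n}} where

  %-*ˡ : ∀ a b → (a % n ℕ.* b) % n ≡ (a ℕ.* b) % n
  %-*ˡ a b = begin
    (a % n ℕ.* b) % n              ≡⟨ %-distribˡ-* (a % n) b n ⟩
    (a % n % n ℕ.* (b % n)) % n    ≡⟨ ≡.cong (λ x → (x ℕ.* (b % n)) % n) (m%n%n≡m%n a n) ⟩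
    (a % n ℕ.* (b % n)) % n        ≡⟨ %-distribˡ-* a b n ⟨
    (a ℕ.* b) % n                  ∎
    where open ≡.≡-Reasoning

  %-*ʳ : ∀ a b → (a ℕ.* (b % n)) % n ≡ (a ℕ.* b) % n
  %-*ʳ a b = begin
    (a ℕ.* (b % n)) % n            ≡⟨ ≡.cong (_% n) (ℕₚ.*-comm a (b % n)) ⟩
    (b % n ℕ.* a) % n              ≡⟨ %-*ˡ b a ⟩
    (b ℕ.* a) % n                  ≡⟨ ≡.cong (_% n) (ℕₚ.*-comm b a) ⟩
    (a ℕ.* b) % n                  ∎
    where open ≡.≡-Reasoning

  coprime⇒invertible : ∀ {k} → Coprime k n → ∃[ x ] (x ℕ.* k) % n ≡ 1 % n
  coprime⇒invertible {k} coprime with coprime-Bézout coprime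
  ... | Bézout.+- x y 1+yn≡xk = x , ≡.trans (≡.cong (_% n) (≡.sym 1+yn≡xk)) ([m+kn]%n≡m%n 1 y n)
  -- Here x k is congruent to -1, so the inverse of k is -x, represented by the natural number (n -
  -- 1) x.
  ... | Bézout.-+ x y 1+xk≡yn = ℕ.pred n ℕ.* x , (begin
    (n′ ℕ.* x ℕ.* k) % n                 ≡⟨ [m+n]%n≡m%n (n′ ℕ.* x ℕ.* k) n ⟨
    (n′ ℕ.* x ℕ.* k ℕ.+ n) % n           ≡⟨ ≡.cong (λ m → (n′ ℕ.* x ℕ.* k ℕ.+ m) % n) (ℕₚ.suc-pred n) ⟨
    (n′ ℕ.* x ℕ.* k ℕ.+ suc n′) % n      ≡⟨ ≡.cong (_% n) (rearrange n′ x k) ⟩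
    (1 ℕ.+ n′ ℕ.* (1 ℕ.+ x ℕ.* k)) % n   ≡⟨ ≡.cong (λ m → (1 ℕ.+ n′ ℕ.* m) % n) 1+xk≡yn ⟩
    (1 ℕ.+ n′ ℕ.* (y ℕ.* n)) % n         ≡⟨ ≡.cong (λ m → (1 ℕ.+ m) % n) (ℕₚ.*-assoc n′ y n) ⟨
    (1 ℕ.+ n′ ℕ.* y ℕ.* n) % n           ≡⟨ [m+kn]%n≡m%n 1 (n′ ℕ.* y) n ⟩
    1 % n                                ∎)
    where
    open ≡.≡-Reasoning
    n′ : ℕ
    n′ = ℕ.pred n

    rearrange : ∀ n x k → n ℕ.* x ℕ.* k ℕ.+ suc n ≡ 1 ℕ.+ n ℕ.* (1 ℕ.+ x ℕ.* k)
    rearrange = solve-∀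

  open GeneratingGraph n

  toℕ-mod : ∀ m → toℕ (m mod n) ≡ m % n
  toℕ-mod m = Finₚ.toℕ-fromℕ< (m%n<n m n)

  coprime⇒generates : ∀ a {b} → Coprime (toℕ b) n → Generates a b
  coprime⇒generates a {b} coprime c with coprime⇒invertible coprime
  -- The coefficient of `a` is 0, and that of `b` is `c` times the inverse of `b`.
  ... | x , xb≡1 = 0 mod n , (toℕ c ℕ.* x) mod n , (begin
    (toℕ (0 mod n) ℕ.* toℕ a ℕ.+ toℕ ((toℕ c ℕ.* x) mod n) ℕ.* toℕ b) % n
      ≡⟨ ≡.cong₂ (λ u v → (u ℕ.* toℕ a ℕ.+ v ℕ.* toℕ b) % n)
           (≡.trans (toℕ-mod 0) (m*n%n≡0 0 n)) (toℕ-mod (toℕ c ℕ.* x)) ⟩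
    ((toℕ c ℕ.* x) % n ℕ.* toℕ b) % n          ≡⟨ %-*ˡ (toℕ c ℕ.* x) (toℕ b) ⟩
    (toℕ c ℕ.* x ℕ.* toℕ b) % n                ≡⟨ ≡.cong (_% n) (ℕₚ.*-assoc (toℕ c) x (toℕ b)) ⟩
    (toℕ c ℕ.* (x ℕ.* toℕ b)) % n              ≡⟨ %-*ʳ (toℕ c) (x ℕ.* toℕ b) ⟨
    (toℕ c ℕ.* ((x ℕ.* toℕ b) % n)) % n        ≡⟨ ≡.cong (λ m → (toℕ c ℕ.* m) % n) xb≡1 ⟩
    (toℕ c ℕ.* (1 % n)) % n                    ≡⟨ %-*ʳ (toℕ c) 1 ⟩
    (toℕ c ℕ.* 1) % n                          ≡⟨ ≡.cong (_% n) (ℕₚ.*-identityʳ (toℕ c)) ⟩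
    toℕ c % n                                  ≡⟨ m<n⇒m%n≡m (Finₚ.toℕ<n c) ⟩
    toℕ c                                      ∎)
    where open ≡.≡-Reasoning

  φ≤deg : ∀ i → toℕ i ≢ 0 → φ n ℕ.≤ deg i
  φ≤deg i i≢0 with subsetProducts-divisible
    (VecAllₚ.fromList⁺ (ListAllₚ.all-filter (λ p → prime? p ×-dec p ∣? n) (List.upTo (suc n)))) i i≢0
  ... | p , (p-prime , p∣n) , p∣dᵢ = count-mono
    (λ k → coprime? (toℕ k) n) (adjacent? (d i mod n)) λ {k} coprime →
    -- Adjacency also requires distinct vertices. A prime `p` dividing both dᵢ and `n` divides the
    -- residue of dᵢ as well, so this residue is not the unit `k`.
    (λ dᵢ≡k → ¬prime[1] (≡.subst Prime (coprime
      (≡.subst (p ∣_) (≡.trans (≡.sym (toℕ-mod (d i))) (≡.cong toℕ dᵢ≡k))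
        (%-presˡ-∣ p∣dᵢ p∣n) , p∣n)) p-prime)) ,
    coprime⇒generates (d i mod n) coprime

-- Comparison of L with the negative of Q̃.

module MatrixComparison {c ℓ₁ ℓ₂ : Level} (ℝ : RealNumbers c ℓ₁ ℓ₂) (n : ℕ) .{{_ : NonZero n}} where
  open RealNumbers ℝ hiding (zero)
  open LinearAlgebra ℝ
  open OrderedField ℝ
  open Spectra ℝ
  open GeneratingGraph n
  open Matrices ℝ

  if-true : ∀ {a p} {A : Set a} {P : Set p} (P? : Dec P) {x y : A} → P → (if does P? then x else y) ≡ x
  if-true P? p = ≡.cong (if_then _ else _) (dec-true P? p)

  if-false : ∀ {a p} {A : Set a} {P : Set p} (P? : Dec P) {x y : A} → ¬ P → (if does P? then x else y) ≡ y
  if-false P? ¬p = ≡.cong (if_then _ else _) (dec-false P? ¬p)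

  ρ-sym : ∀ i j → ρ i j ≡ ρ j i
  ρ-sym i j with toℕ i in i≡ | toℕ j in j≡
  ... | zero  | zero  = ≡.cong (λ k → √ (fromℕ (φ n ℕ.* a k))) (Finₚ.toℕ-injective (≡.trans j≡ (≡.sym i≡)))
  ... | zero  | suc _ = ≡.refl
  ... | suc _ | zero  = ≡.refl
  ... | suc _ | suc _ = ≡.cong₂ (λ g k → if does (g ℕ.≟ 1) then √ (fromℕ k) else 0#)
    (gcd-comm (d i) (d j)) (ℕₚ.*-comm (a i) (a j))

  Q̃-sym : ∀ i j → Q̃ i j ≡ Q̃ j i
  Q̃-sym i j with i Fin.≟ j
  ... | yes ≡.refl = ≡.sym (if-true (i Fin.≟ i) ≡.refl)
  ... | no i≢j = ≡.trans (ρ-sym i j) (≡.sym (if-false (j Fin.≟ i) λ j≡i → i≢j (≡.sym j≡i)))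

  L-sym : ∀ i j → L i j ≡ L j i
  L-sym i j with i Fin.≟ j
  ... | yes ≡.refl = ≡.sym (if-true (i Fin.≟ i) ≡.refl)
  ... | no i≢j = ≡.trans (≡.cong -_ (ρ-sym i j)) (≡.sym (if-false (j Fin.≟ i) λ j≡i → i≢j (≡.sym j≡i)))

  -Q̃≈L : ∀ i j → i ≢ j → neg Q̃ i j ≈ L i j
  -Q̃≈L i j i≢j = reflexive (≡.trans (≡.cong -_ (if-false (i Fin.≟ j) i≢j)) (≡.sym (if-false (i Fin.≟ j) i≢j)))

  φ≤n : φ n ℕ.≤ n
  φ≤n = count≤n (λ k → coprime? (toℕ k) n)

  private
    -- Away from the first index the diagonal of `Q̃` vanishes, so the difference is the diagonal
    -- entry of `L` itself.
    off-zero : ∀ i {δ} → toℕ i ≢ 0 →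
      (if does (suc (toℕ i) ℕₚ.≟ 2 ℕ.^ r) then fromℕ (φ n) else fromℕ (deg i)) ≡ δ →
      L i i ≈ neg Q̃ i i + δ
    off-zero i {δ} i≢0 eq = trans
      (reflexive (≡.trans (if-true (i Fin.≟ i) ≡.refl) (≡.trans (if-false (toℕ i ℕₚ.≟ 0) i≢0) eq)))
      (trans (solve 1 (λ x → x := (:- :0) :+ x) refl δ) (+-congʳ (-‿cong (reflexive (≡.sym
        (≡.trans (if-true (i Fin.≟ i) ≡.refl) (if-false (toℕ i ℕₚ.≟ 0) i≢0)))))))

  diagonal-difference : ∀ i → ∃[ δ ] L i i ≈ neg Q̃ i i + δ × fromℕ (φ n) ≤ δ × δ ≤ fromℕ n
  diagonal-difference i with toℕ i ℕₚ.≟ 0 | suc (toℕ i) ℕₚ.≟ 2 ℕ.^ r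
  ... | yes i≡0 | _ = fromℕ n
    , trans (reflexive (≡.trans (if-true (i Fin.≟ i) ≡.refl) (if-true (toℕ i ℕₚ.≟ 0) i≡0)))
        (trans (+-comm _ _) (+-congʳ (-‿cong (reflexive (≡.sym
          (≡.trans (if-true (i Fin.≟ i) ≡.refl) (if-true (toℕ i ℕₚ.≟ 0) i≡0)))))))
    , fromℕ-mono φ≤n , ≈⇒≤ refl
  ... | no i≢0 | yes last = fromℕ (φ n)
    , off-zero i i≢0 (if-true (suc (toℕ i) ℕₚ.≟ 2 ℕ.^ r) last)
    , ≈⇒≤ refl , fromℕ-mono φ≤n
  ... | no i≢0 | no ¬last = fromℕ (deg i)
    , off-zero i i≢0 (if-false (suc (toℕ i) ℕₚ.≟ 2 ℕ.^ r) ¬last)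
    , fromℕ-mono (φ≤deg n i i≢0)
    , fromℕ-mono (count≤n (adjacent? _))

  open Weyl ℝ using (eigenvalue-mono; form-mono)

  lower : ∀ {λQ λL} → IsSpectrum (neg Q̃) λQ → IsSpectrum L λL → ∀ j → λQ j + fromℕ (φ n) ≤ λL j
  lower Q-spec L-spec = eigenvalue-mono
    (λ i j → -‿cong (reflexive (Q̃-sym i j))) (λ i j → reflexive (L-sym i j)) Q-spec L-spec (fromℕ (φ n))
    (form-mono (neg Q̃) L (fromℕ (φ n))
      (λ i → let δ , eq , φ≤δ , _ = diagonal-difference i in
        ≤-respʳ (sym eq) (+-mono-≤ (≈⇒≤ refl) φ≤δ))
      -Q̃≈L)

  -- Monotonicity with the two matrices exchanged and the shift t = -n; the summand n then moves to
  -- the other side.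
  upper : ∀ {λQ λL} → IsSpectrum (neg Q̃) λQ → IsSpectrum L λL → ∀ j → λL j ≤ λQ j + fromℕ n
  upper {λQ} {λL} Q-spec L-spec j = ≤-respˡ
    (solve 2 (λ l n → (l :- n) :+ n := l) refl (λL j) (fromℕ n))
    (+-mono-≤ (eigenvalue-mono
      (λ i j → reflexive (L-sym i j)) (λ i j → -‿cong (reflexive (Q̃-sym i j))) L-spec Q-spec (- fromℕ n)
      (form-mono L (neg Q̃) (- fromℕ n)
        (λ i → let δ , eq , _ , δ≤n = diagonal-difference i in
          ≤-respˡ (+-congʳ (sym eq)) (≤-respʳ
            (solve 2 (λ q n → (q :+ n) :- n := q) refl (neg Q̃ i i) (fromℕ n))
            (+-mono-≤ (+-mono-≤ (≈⇒≤ refl) δ≤n) (≈⇒≤ refl))))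
        (λ i j i≢j → sym (-Q̃≈L i j i≢j))) j) (≈⇒≤ refl))

theorem5p0p4 :
  ∀ {c ℓ₁ ℓ₂} (ℝ : RealNumbers c ℓ₁ ℓ₂) (n : ℕ) .{{_ : NonZero n}} → 2 ℕ.≤ n →
  let open RealNumbers ℝ
      open LinearAlgebra ℝ
      open GeneratingGraph n
      open Matrices ℝ
  in
  (λQ λL : Fin (2 ℕ.^ r) → Carrier) →
  IsSpectrum (neg Q̃) λQ →
  IsSpectrum L λL →
  (j : Fin (2 ℕ.^ r)) →
  (λQ j + fromℕ (φ n) ≤ λL j) × (λL j ≤ λQ j + fromℕ n)
theorem5p0p4 ℝ n _ λQ λL Q-spec L-spec j = lower Q-spec L-spec j , upper Q-spec L-spec j
  where open MatrixComparison ℝ n
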